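{- Let $(Q_{n,k})$ be a regular B-representable family of polynomials, and for all integers $n,k$ put $Q_{n,k}:=B_{n,k}(Q_{1,1},Q_{2,1},\ldots)$ and $Q^{\perp}_{n,k}:=A_{n,k}(Q_{1,1},Q_{2,1},\ldots)$, with $B_{n,k},A_{n,k}$ the integer-indexed polynomials defined in the context. Then for all $n,k\in\mathbb{Z}$: $Q^{\perp}_{n,k}=(-1)^{n-k}Q_{ -k,-n}$.
   Context: $\mathbb{K}$ is a field of characteristic zero. Binomial coefficients: for integers $m$ and $j\ge0$, $\binom mj=m(m-1)\cdots(m-j+1)/j!$; for $j<0$: $\binom mj=0$ if $m\ge0$, and for $m=-N<0$: $\binom{ -N}{j}=0$ if $j>-N$, and $\binom{ -N}{j}=\binom{ -N}{ -N-j}$ otherwise. Partial Bell polynomials for $n,k\ge0$: $B_{0,0}=1$, $B_{n,0}=0$ ($n\ge1$), $B_{n,k}=0$ ($k>n$), and for $1\le k\le n$, $B_{n,k}=\sum\frac{n!}{\prod_i r_i!(i!)^{r_i}}\prod_iX_i^{r_i}$ over non-negative integers with $\sum r_i=k$, $\sum ir_i=n$. Potential polynomials: for $m\ge0$ and $r\in\mathbb{Z}$, $\widehat P_{m,r}:=\sum_{j=0}^m r(r-1)\cdots(r-j+1)\,X_0^{r-j}B_{m,j}$ (Laurent polynomials in $X_0$), and $\widehat P_{m,r}:=0$ for $m<0$; reciprocal polynomials $\widehat R_m:=\widehat P_{m,-1}$. For arbitrary $n,k\in\mathbb{Z}$ the polynomials are (re)defined by $B_{n,k}:=\binom nk\widehat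 P_{n-k,k}(\tfrac{X_1}{1},\tfrac{X_2}{2},\ldots,\tfrac{X_{n-k+1}}{n-k+1})$ and $A_{n,k}:=\binom{n-1}{k-1}\widehat P_{n-k,n}\big(\widehat R_0(\tfrac{X_1}1),\widehat R_1(\tfrac{X_1}1,\tfrac{X_2}2),\ldots,\widehat R_{n-k}(\tfrac{X_1}1,\ldots,\tfrac{X_{n-k+1}}{n-k+1})\big)$ (here $\widehat P_{m,r}(Y_0,\ldots,Y_m)$ means $X_i\mapsto Y_i$); for $n\ge k\ge1$ these agree with the Bell polynomials and with their orthogonal companions $A_{n,k}$ (the unique triangular family with $\sum_{j=k}^nA_{n,j}B_{j,k}=\delta_{nk}$). A family $(Q_{n,k})_{1\le k\le n}$ is B-representable if there are polynomials $H_j$ with $Q_{n,k}=B_{n,k}(H_1,\ldots,H_{n-k+1})$ for all $1\le k\le n$; it is regular if its lower triangular matrices are nonsingular (equivalently $Q_{1,1}$ is invertible). $P(H_1,H_2,\ldots)$ means substitution of $H_j$ for $X_j$. -}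

module Defs where

open import Algebra.Bundles using (CommutativeRing)
open import Data.Nat as ℕ using (ℕ; zero; suc; NonZero; _!)
open import Data.Nat.Properties using (_!≢0; m*n≢0; m^n≢0)
open import Data.Nat.DivMod using (_/_)
open import Data.Integer as ℤ using (ℤ; +_; -[1+_])
open import Data.List using (List; []; _∷_; concatMap; map; foldr; upTo)
open import Data.Vec using (Vec; []; _∷_)
open import Data.Bool using (Bool; true; false; if_then_else_; _∧_)

vecsUpTo : (len b : ℕ) → List (Vec ℕ len)
vecsUpTo zero    b = [] ∷ []
vecsUpTo (suc len) b = concatMap (λ x → map (x ∷_) (vecsUpTo len b)) (upTo (suc b))

sumV : ∀ {len} → Vec ℕ len → ℕ
sumV []       = 0
sumV (r ∷ rs) = r ℕ.+ sumV rs

wsumFrom : ∀ {len} → ℕ → Vec ℕ len → ℕ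
wsumFrom i []       = 0
wsumFrom i (r ∷ rs) = i ℕ.* r ℕ.+ wsumFrom (suc i) rs

denomFrom : ∀ {len} → ℕ → Vec ℕ len → ℕ
denomFrom i []       = 1
denomFrom i (r ∷ rs) = (r ! ℕ.* (i !) ℕ.^ r) ℕ.* denomFrom (suc i) rs

denomFrom-nz : ∀ {len} (i : ℕ) (v : Vec ℕ len) → NonZero (denomFrom i v)
denomFrom-nz i []       = _
denomFrom-nz i (r ∷ rs) =
  let instance _ = r !≢0
               _ = i !≢0
               _ = m^n≢0 (i !) r
               _ = m*n≢0 (r !) ((i !) ℕ.^ r)
               _ = denomFrom-nz (suc i) rs
  in m*n≢0 (r ! ℕ.* (i !) ℕ.^ r) (denomFrom (suc i) rs)

bellCoef : ∀ {len} → ℕ → Vec ℕ len → ℕ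
bellCoef n r = (n ! / denomFrom 1 r) {{denomFrom-nz 1 r}}

module Poly {c ℓ} (R : CommutativeRing c ℓ) where
  open CommutativeRing R

  fromℕ : ℕ → Carrier
  fromℕ zero    = 0#
  fromℕ (suc n) = 1# + fromℕ n

  fromℤ : ℤ → Carrier
  fromℤ (+ n)      = fromℕ n
  fromℤ -[1+ n ]   = - fromℕ (suc n)

  _^_ : Carrier → ℕ → Carrier
  x ^ zero  = 1#
  x ^ suc n = x * (x ^ n)

  sumL : List Carrier → Carrier
  sumL = foldr _+_ 0#

  zpow : Carrier → Carrier → ℤ → Carrier
  zpow x xinv (+ n)     = x ^ n
  zpow x xinv -[1+ n ]  = xinv ^ suc n

  sgn : ℤ → Carrier
  sgn m = (- 1#) ^ ℤ.∣ m ∣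

  fall : ℤ → ℕ → ℤ
  fall r zero    = + 1
  fall r (suc j) = fall r j ℤ.* (r ℤ.- + j)

  monoFrom : ∀ {len} → (ℕ → Carrier) → ℕ → Vec ℕ len → Carrier
  monoFrom X i []       = 1#
  monoFrom X i (r ∷ rs) = (X i ^ r) * monoFrom X (suc i) rs

  -- Partial Bell polynomial B_{n,k}(X_1,X_2,...) for n,k ≥ 0, by the
  -- explicit defining sum over (r_1,...,r_n) with Σ r_i = k, Σ i r_i = n.
  -- (Each r_i ≤ n, so enumerating entries in 0..n is exhaustive.)
  Bell : ℕ → ℕ → (ℕ → Carrier) → Carrier
  Bell n k X = sumL (map term (vecsUpTo n n))
    where
    term : Vec ℕ n → Carrier
    term r = if (sumV r ℕ.≡ᵇ k) ∧ (wsumFrom 1 r ℕ.≡ᵇ n)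
             then fromℕ (bellCoef n r) * monoFrom X 1 r
             else 0#

  module WithInverses (inv : ℕ → Carrier) where
    -- inv n is (assumed to be) the inverse of n+1 in R

    invFact : ℕ → Carrier
    invFact zero    = 1#
    invFact (suc n) = inv n * invFact n

    binomNN : ℤ → ℕ → Carrier
    binomNN m j = fromℤ (fall m j) * invFact j

    binomZ : ℤ → ℤ → Carrier
    binomZ m (+ j)               = binomNN m j
    binomZ (+ _) -[1+ j ]        = 0#
    -- m = -N with N = N'+1, j = -(j'+1):  j > -N  iff  j' < N';
    -- otherwise binom(-N, -N-j) with -N-j = j' - N'
    binomZ -[1+ N' ] -[1+ j' ]   =
      if j' ℕ.<ᵇ N' then 0# else binomNN -[1+ N' ] (j' ℕ.∸ N')

    -- Potential polynomial  P̂_{m,r}(Z_0,...,Z_m), m,r ∈ ℤ, where z0inv is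
    -- an inverse of Z_0 (needed for the Laurent powers Z_0^{r-j}).
    Phat : ℤ → ℤ → (ℕ → Carrier) → Carrier → Carrier
    Phat -[1+ _ ] r Z z0inv = 0#
    Phat (+ m)    r Z z0inv =
      sumL (map (λ j → (fromℤ (fall r j) * zpow (Z 0) z0inv (r ℤ.- + j)) * Bell m j Z)
                (upTo (suc m)))

    Rhat : ℤ → (ℕ → Carrier) → Carrier → Carrier
    Rhat m Z z0inv = Phat m (ℤ.- + 1) Z z0inv

    Yshift : (ℕ → Carrier) → ℕ → Carrier
    Yshift Y i = Y (suc i) * inv i

    Bext : ℤ → ℤ → (ℕ → Carrier) → Carrier → Carrier
    Bext n k Y y1inv =
      binomZ n k * Phat (n ℤ.- k) k (Yshift Y) (y1inv * fromℕ 1)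

    Aext : ℤ → ℤ → (ℕ → Carrier) → Carrier → Carrier
    Aext n k Y y1inv =
      binomZ (n ℤ.- + 1) (k ℤ.- + 1) * Phat (n ℤ.- k) n W (Yshift Y 0)
      where
      -- W_i = R̂_i(Y_1/1, ..., Y_{i+1}/(i+1));  W_0 = (Y_1/1)^{-1}, whose
      -- inverse is Y_1/1
      W : ℕ → Carrier
      W i = Rhat (+ i) (Yshift Y) (y1inv * fromℕ 1)

{-# OPTIONS --safe #-}
module Submission where

-- Over a ring containing ℚ, B_{n,k}/n! is the coefficient of tⁿ in Fᵏ/k! with F = Σ_{i≥1} Xᵢ tⁱ/i!.
-- Hence P̂_{m,r}(Z)/m! is the coefficient of tᵐ in the binomial series of (Z₀ + F)ʳ, that is, in the
-- r-th power of the exponential generating function Z(t). The arguments R̂ᵢ of P̂_{n-k,n} in A_{n,k}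
-- are the coefficients of 1/Z(t), so this factor is P̂_{n-k,-n}(Z), which is also the factor in
-- B_{-k,-n}. What remains is binom(n-1,k-1) = (-1)^{n-k} binom(-k,-n) for n ≥ k.

open import Defs
open import Level using (_⊔_)
open import Algebra.Bundles using (CommutativeRing)
open import Data.Bool using (true; false; if_then_else_; _∧_; T)
open import Data.Empty using (⊥-elim)
open import Data.Integer as ℤ using (ℤ; +_; -[1+_])
import Data.Integer.Properties as ℤₚ
open import Data.Integer.Solver using () renaming (module +-*-Solver to ℤ-Solver)
open import Data.List using (List; []; _∷_; _++_; concatMap; map; applyUpTo; upTo)
open import Data.List.Properties using (map-∘; map-upTo)
open import Data.Nat as ℕ using (ℕ; zero; suc; _≤_; _<_; z≤n; s≤s; _!)
open import Data.Nat.Combinatorics using (k![n∸k]!∣n!)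
open import Data.Nat.Divisibility using (_∣_; ∣-refl; ∣-trans; ∣-reflexive; *-pres-∣)
open import Data.Nat.DivMod using (m/n*n≡m)
import Data.Nat.Properties as ℕₚ
open import Data.Nat.Solver using (module +-*-Solver)
open import Data.Product using (_,_)
open import Data.Vec using (Vec; []; _∷_)
open import Relation.Binary.PropositionalEquality as ≡ using (_≡_)
open import Relation.Nullary using (yes; no)

-- Two obstacles shape the proof. `Bell` is a sum over a finite box of exponent vectors, with a
-- truncating quotient of naturals as coefficient. It is turned into a product by a second formal
-- variable u: over the ring of series in t, the sequence k ↦ Fᵏ/k! is exp(uF), characterised by a
-- linear recurrence. The exponentials of the single terms Xᵢ tⁱ/i! therefore multiply to exp(uF)
-- without a multinomial theorem. The other obstacle is Z(t)ʳ for negative r, which is never defined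
-- as a power. The binomial series is only shown to satisfy Z(t)·Pᵣ = Pᵣ₊₁ and P₀ = 1. Since Z(t) is
-- invertible, these relations fix the whole two-sided sequence, and comparing two such sequences
-- gives (1/Z)ʳ = Z⁻ʳ.

MutuallyInverse : ∀ {c ℓ} (R : CommutativeRing c ℓ) → (x y : CommutativeRing.Carrier R) → Set ℓ
MutuallyInverse R x y = x * y ≈ 1#
  where open CommutativeRing R

-- The homomorphism from the integers to a commutative ring.

module RingHom {c ℓ} (R : CommutativeRing c ℓ) where
  open CommutativeRing R hiding (zero)
  open Poly R
  open import Algebra.Properties.Ring ring
  open import Algebra.Properties.CommutativeSemigroup +-commutativeSemigroup using (interchange)
  open import Relation.Binary.Reasoning.Setoid setoid

  fromℕ-+ : ∀ m n → fromℕ (m ℕ.+ n) ≈ fromℕ m + fromℕ n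
  fromℕ-+ zero    n = sym (+-identityˡ _)
  fromℕ-+ (suc m) n = trans (+-congˡ (fromℕ-+ m n)) (sym (+-assoc _ _ _))

  fromℕ-* : ∀ m n → fromℕ (m ℕ.* n) ≈ fromℕ m * fromℕ n
  fromℕ-* zero    n = sym (zeroˡ _)
  fromℕ-* (suc m) n = begin
    fromℕ (n ℕ.+ m ℕ.* n)             ≈⟨ fromℕ-+ n (m ℕ.* n) ⟩
    fromℕ n + fromℕ (m ℕ.* n)         ≈⟨ +-cong (sym (*-identityˡ _)) (fromℕ-* m n) ⟩
    1# * fromℕ n + fromℕ m * fromℕ n  ≈⟨ sym (distribʳ _ _ _) ⟩
    fromℕ (suc m) * fromℕ n           ∎

  fromℤ-⊖ : ∀ m n → fromℤ (m ℤ.⊖ n) ≈ fromℕ m - fromℕ n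
  fromℤ-⊖ zero    zero    = sym (-‿inverseʳ 0#)
  fromℤ-⊖ zero    (suc n) = sym (+-identityˡ _)
  fromℤ-⊖ (suc m) zero    = sym (trans (+-congˡ -0#≈0#) (+-identityʳ _))
  fromℤ-⊖ (suc m) (suc n) = begin
    fromℤ (suc m ℤ.⊖ suc n)              ≡⟨ ≡.cong fromℤ (ℤₚ.[1+m]⊖[1+n]≡m⊖n m n) ⟩
    fromℤ (m ℤ.⊖ n)                      ≈⟨ fromℤ-⊖ m n ⟩
    fromℕ m - fromℕ n                    ≈⟨ sym (+-identityˡ _) ⟩
    0# + (fromℕ m - fromℕ n)             ≈⟨ +-congʳ (sym (-‿inverseʳ 1#)) ⟩
    (1# - 1#) + (fromℕ m - fromℕ n)      ≈⟨ interchange _ _ _ _ ⟩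
    (1# + fromℕ m) + (- 1# - fromℕ n)    ≈⟨ +-congˡ (-‿+-comm _ _) ⟩
    fromℕ (suc m) - fromℕ (suc n)        ∎

  fromℤ-+ : ∀ x y → fromℤ (x ℤ.+ y) ≈ fromℤ x + fromℤ y
  fromℤ-+ (+ m)    (+ n)    = fromℕ-+ m n
  fromℤ-+ (+ m)    -[1+ n ] = fromℤ-⊖ m (suc n)
  fromℤ-+ -[1+ m ] (+ n)    = trans (fromℤ-⊖ n (suc m)) (+-comm _ _)
  fromℤ-+ -[1+ m ] -[1+ n ] = begin
    - fromℕ (suc (suc (m ℕ.+ n)))     ≡⟨ ≡.cong (λ k → - fromℕ (suc k)) (≡.sym (ℕₚ.+-suc m n)) ⟩
    - fromℕ (suc m ℕ.+ suc n)         ≈⟨ -‿cong (fromℕ-+ (suc m) (suc n)) ⟩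
    - (fromℕ (suc m) + fromℕ (suc n)) ≈⟨ sym (-‿+-comm _ _) ⟩
    - fromℕ (suc m) - fromℕ (suc n)   ∎

  fromℤ-neg : ∀ x → fromℤ (ℤ.- x) ≈ - fromℤ x
  fromℤ-neg (+ zero)  = sym -0#≈0#
  fromℤ-neg (+ suc n) = refl
  fromℤ-neg -[1+ n ]  = sym (-‿involutive _)

  fromℤ-pos-* : ∀ m y → fromℤ (+ m ℤ.* y) ≈ fromℕ m * fromℤ y
  fromℤ-pos-* zero    y = sym (zeroˡ _)
  fromℤ-pos-* (suc m) y = begin
    fromℤ (+ suc m ℤ.* y)             ≡⟨ ≡.cong fromℤ (ℤₚ.suc-* (+ m) y) ⟩
    fromℤ (y ℤ.+ + m ℤ.* y)           ≈⟨ fromℤ-+ y (+ m ℤ.* y) ⟩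
    fromℤ y + fromℤ (+ m ℤ.* y)       ≈⟨ +-cong (sym (*-identityˡ _)) (fromℤ-pos-* m y) ⟩
    1# * fromℤ y + fromℕ m * fromℤ y  ≈⟨ sym (distribʳ _ _ _) ⟩
    fromℕ (suc m) * fromℤ y           ∎

  fromℤ-* : ∀ x y → fromℤ (x ℤ.* y) ≈ fromℤ x * fromℤ y
  fromℤ-* (+ m)    y = fromℤ-pos-* m y
  fromℤ-* -[1+ m ] y = begin
    fromℤ (-[1+ m ] ℤ.* y)         ≡⟨ ≡.cong fromℤ (≡.sym (ℤₚ.neg-distribˡ-* (+ suc m) y)) ⟩
    fromℤ (ℤ.- (+ suc m ℤ.* y))    ≈⟨ fromℤ-neg (+ suc m ℤ.* y) ⟩
    - fromℤ (+ suc m ℤ.* y)        ≈⟨ -‿cong (fromℤ-pos-* (suc m) y) ⟩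
    - (fromℕ (suc m) * fromℤ y)    ≈⟨ -‿distribˡ-* _ _ ⟩
    - fromℕ (suc m) * fromℤ y      ∎

-- Formal power series over a commutative ring.

module Series {c ℓ} (R : CommutativeRing c ℓ) where
  open CommutativeRing R hiding (zero)
  open Poly R using (fromℕ)
  open import Relation.Binary.Reasoning.Setoid setoid
  open import Algebra.Solver.Ring.NaturalCoefficients.Default commutativeSemiring
    using (solve; _:=_; _:+_; _:*_)

  infixl 7 _⊛_

  -- The Cauchy product, by recursion on the coefficient index, splitting off the constant term of
  -- the left factor. The ring laws become inductions on the index, without double sums.
  _⊛_ : (ℕ → Carrier) → (ℕ → Carrier) → ℕ → Carrier
  (f ⊛ g) zero    = f 0 * g 0
  (f ⊛ g) (suc n) = f 0 * g (suc n) + ((λ i → f (suc i)) ⊛ g) n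

  -- Licence for truncation: series that agree modulo t^(n+1) may be exchanged inside a product when
  -- only its coefficient at n is read.
  ⊛-cong-≤ : ∀ {f f′ g g′} n → (∀ i → i ≤ n → f i ≈ f′ i) → (∀ i → i ≤ n → g i ≈ g′ i) →
             (f ⊛ g) n ≈ (f′ ⊛ g′) n
  ⊛-cong-≤ zero    p q = *-cong (p 0 z≤n) (q 0 z≤n)
  ⊛-cong-≤ (suc n) p q = +-cong (*-cong (p 0 z≤n) (q (suc n) ℕₚ.≤-refl))
    (⊛-cong-≤ n (λ i i≤n → p (suc i) (s≤s i≤n)) (λ i i≤n → q i (ℕₚ.m≤n⇒m≤1+n i≤n)))

  ⊛-cong : ∀ {f f′ g g′} → (∀ i → f i ≈ f′ i) → (∀ i → g i ≈ g′ i) → ∀ n → (f ⊛ g) n ≈ (f′ ⊛ g′) n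
  ⊛-cong p q n = ⊛-cong-≤ n (λ i _ → p i) (λ i _ → q i)

  ⊛-zeroˡ : ∀ g n → ((λ _ → 0#) ⊛ g) n ≈ 0#
  ⊛-zeroˡ g zero    = zeroˡ _
  ⊛-zeroˡ g (suc n) = trans (+-cong (zeroˡ _) (⊛-zeroˡ g n)) (+-identityˡ _)

  ⊛-distribʳ : ∀ h f g n → ((λ i → f i + g i) ⊛ h) n ≈ (f ⊛ h) n + (g ⊛ h) n
  ⊛-distribʳ h f g zero    = distribʳ _ _ _
  ⊛-distribʳ h f g (suc n) = trans (+-congˡ (⊛-distribʳ h _ _ n))
    (solve 5 (λ a b c x y → (a :+ b) :* c :+ (x :+ y) := (a :* c :+ x) :+ (b :* c :+ y)) refl _ _ _ _ _)

  ⊛-scaleˡ : ∀ a f g n → ((λ i → a * f i) ⊛ g) n ≈ a * (f ⊛ g) n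
  ⊛-scaleˡ a f g zero    = *-assoc _ _ _
  ⊛-scaleˡ a f g (suc n) = trans (+-cong (*-assoc _ _ _) (⊛-scaleˡ a _ g n)) (sym (distribˡ _ _ _))

  -- The mirror image of the defining recursion, splitting off the constant term of `g`; it turns
  -- commutativity into an induction.
  ⊛-sucʳ : ∀ f g n → (f ⊛ g) (suc n) ≈ f (suc n) * g 0 + (f ⊛ (λ i → g (suc i))) n
  ⊛-sucʳ f g zero    = +-comm _ _
  ⊛-sucʳ f g (suc n) = trans (+-congˡ (⊛-sucʳ (λ i → f (suc i)) g n))
    (solve 3 (λ a b c → a :+ (b :+ c) := b :+ (a :+ c)) refl _ _ _)

  ⊛-comm : ∀ f g n → (f ⊛ g) n ≈ (g ⊛ f) n
  ⊛-comm f g zero    = *-comm _ _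
  ⊛-comm f g (suc n) = trans (+-cong (*-comm _ _) (⊛-comm (λ i → f (suc i)) g n)) (sym (⊛-sucʳ g f n))

  ⊛-assoc : ∀ f g h n → ((f ⊛ g) ⊛ h) n ≈ (f ⊛ (g ⊛ h)) n
  ⊛-assoc f g h zero    = *-assoc _ _ _
  ⊛-assoc f g h (suc n) = begin
    f 0 * g 0 * h (suc n) + ((λ i → f 0 * g (suc i) + (f′ ⊛ g) i) ⊛ h) n
      ≈⟨ +-congˡ (⊛-distribʳ h _ _ n) ⟩
    f 0 * g 0 * h (suc n) + (((λ i → f 0 * g′ i) ⊛ h) n + ((f′ ⊛ g) ⊛ h) n)
      ≈⟨ +-congˡ (+-cong (⊛-scaleˡ (f 0) g′ h n) (⊛-assoc f′ g h n)) ⟩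
    f 0 * g 0 * h (suc n) + (f 0 * (g′ ⊛ h) n + (f′ ⊛ (g ⊛ h)) n)
      ≈⟨ solve 5 (λ a b c x y → a :* b :* c :+ (a :* x :+ y) := a :* (b :* c :+ x) :+ y) refl _ _ _ _ _ ⟩
    f 0 * (g 0 * h (suc n) + (g′ ⊛ h) n) + (f′ ⊛ (g ⊛ h)) n ∎
    where
    f′ g′ : ℕ → Carrier
    f′ i = f (suc i)
    g′ i = g (suc i)

  monomial : Carrier → ℕ → ℕ → Carrier
  monomial a zero    zero    = a
  monomial a zero    (suc n) = 0#
  monomial a (suc p) zero    = 0#
  monomial a (suc p) (suc n) = monomial a p n

  shift : ℕ → (ℕ → Carrier) → ℕ → Carrier
  shift zero    g n       = g n
  shift (suc p) g zero    = 0#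
  shift (suc p) g (suc n) = shift p g n

  monomial-⊛ : ∀ a p g n → (monomial a p ⊛ g) n ≈ a * shift p g n
  monomial-⊛ a zero    g zero    = refl
  monomial-⊛ a zero    g (suc n) = trans (+-congˡ (⊛-zeroˡ g n)) (+-identityʳ _)
  monomial-⊛ a (suc p) g zero    = trans (zeroˡ _) (sym (zeroʳ _))
  monomial-⊛ a (suc p) g (suc n) = trans (+-cong (zeroˡ _) (monomial-⊛ a p g n)) (+-identityˡ _)

  monomial-cong : ∀ {a b} → a ≈ b → ∀ p n → monomial a p n ≈ monomial b p n
  monomial-cong e zero    zero    = e
  monomial-cong e zero    (suc n) = refl
  monomial-cong e (suc p) zero    = refl
  monomial-cong e (suc p) (suc n) = monomial-cong e p n

  shift-monomial : ∀ a p b q n → a * shift p (monomial b q) n ≈ monomial (a * b) (p ℕ.+ q) n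
  shift-monomial a zero    b zero    zero    = refl
  shift-monomial a zero    b zero    (suc n) = zeroʳ _
  shift-monomial a zero    b (suc q) zero    = zeroʳ _
  shift-monomial a zero    b (suc q) (suc n) = shift-monomial a zero b q n
  shift-monomial a (suc p) b q       zero    = zeroʳ _
  shift-monomial a (suc p) b q       (suc n) = shift-monomial a p b q n

  monomial-* : ∀ a p b q n → (monomial a p ⊛ monomial b q) n ≈ monomial (a * b) (p ℕ.+ q) n
  monomial-* a p b q n = trans (monomial-⊛ a p _ n) (shift-monomial a p b q n)

  monomial-self : ∀ a p → monomial a p p ≈ a
  monomial-self a zero    = refl
  monomial-self a (suc p) = monomial-self a p

  monomial-other : ∀ a {p n} → p ≡.≢ n → monomial a p n ≈ 0#
  monomial-other a {zero}  {zero}  p≢n with () ← p≢n ≡.refl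
  monomial-other a {zero}  {suc n} p≢n = refl
  monomial-other a {suc p} {zero}  p≢n = refl
  monomial-other a {suc p} {suc n} p≢n = monomial-other a (λ e → p≢n (≡.cong suc e))

  -- Packaged as a `CommutativeRing` so that the construction can be iterated: series in u over this
  -- ring keep the two indices k and n of a Bell polynomial apart.
  seriesRing : CommutativeRing c ℓ
  seriesRing = record
    { Carrier = ℕ → Carrier
    ; _≈_ = λ f g → ∀ n → f n ≈ g n
    ; _+_ = λ f g n → f n + g n
    ; _*_ = _⊛_
    ; -_ = λ f n → - f n
    ; 0# = λ _ → 0#
    ; 1# = monomial 1# 0
    ; isCommutativeRing = record
      { isRing = record
        { +-isAbelianGroup = record
          { isGroup = record
            { isMonoid = record
              { isSemigroup = record
                { isMagma = record
                  { isEquivalence = record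
                    { refl = λ _ → refl
                    ; sym = λ p n → sym (p n)
                    ; trans = λ p q n → trans (p n) (q n)
                    }
                  ; ∙-cong = λ p q n → +-cong (p n) (q n)
                  }
                ; assoc = λ f g h n → +-assoc _ _ _
                }
              ; identity = (λ f n → +-identityˡ _) , (λ f n → +-identityʳ _)
              }
            ; inverse = (λ f n → -‿inverseˡ _) , (λ f n → -‿inverseʳ _)
            ; ⁻¹-cong = λ p n → -‿cong (p n)
            }
          ; comm = λ f g n → +-comm _ _
          }
        ; *-cong = ⊛-cong
        ; *-assoc = ⊛-assoc
        ; *-identity = one-⊛ , λ f n → trans (⊛-comm f _ n) (one-⊛ f n)
        ; distrib = (λ f g h n → trans (⊛-comm f _ n)
                       (trans (⊛-distribʳ f g h n) (+-cong (⊛-comm g f n) (⊛-comm h f n))))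
                  , ⊛-distribʳ
        }
      ; *-comm = ⊛-comm
      }
    }
    where
    one-⊛ : ∀ f n → (monomial 1# 0 ⊛ f) n ≈ f n
    one-⊛ f n = trans (monomial-⊛ 1# 0 f n) (*-identityˡ _)

  fromℕ-series : ∀ k n → Poly.fromℕ seriesRing k n ≈ monomial (fromℕ k) 0 n
  fromℕ-series zero    zero    = refl
  fromℕ-series zero    (suc n) = refl
  fromℕ-series (suc k) zero    = +-congˡ (fromℕ-series k 0)
  fromℕ-series (suc k) (suc n) = trans (+-identityˡ _) (fromℕ-series k (suc n))

  -- t d/dt rather than d/dt: the product rule then stays at a single index.
  θ : (ℕ → Carrier) → ℕ → Carrier
  θ f n = fromℕ n * f n

  θ-⊛ : ∀ f g n → θ (f ⊛ g) n ≈ (θ f ⊛ g) n + (f ⊛ θ g) n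
  θ-⊛ f g zero    = trans (zeroˡ _) (sym (trans (+-cong (trans (*-congʳ (zeroˡ _)) (zeroˡ _))
                      (trans (*-congˡ (zeroˡ _)) (zeroʳ _))) (+-identityˡ _)))
  θ-⊛ f g (suc n) = begin
    (1# + fromℕ n) * (f 0 * g (suc n) + (f′ ⊛ g) n)
      ≈⟨ trans (distribˡ _ _ _) (+-congˡ (distribʳ _ _ _)) ⟩
    (1# + fromℕ n) * (f 0 * g (suc n)) + (1# * (f′ ⊛ g) n + θ (f′ ⊛ g) n)
      -- `θ` does not commute with dropping the constant term: `θ f (suc i)` is `f′ i` plus
      -- `θ f′ i`. The summand with factor `1#` supplies the difference.
      ≈⟨ +-congˡ (+-cong (sym (⊛-scaleˡ 1# f′ g n)) (θ-⊛ f′ g n)) ⟩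
    (1# + fromℕ n) * (f 0 * g (suc n)) + (((λ i → 1# * f′ i) ⊛ g) n + ((θ f′ ⊛ g) n + (f′ ⊛ θ g) n))
      ≈⟨ solve 6 (λ s a b x y z → s :* (a :* b) :+ (x :+ (y :+ z)) := (x :+ y) :+ (a :* (s :* b) :+ z))
           refl _ _ _ _ _ _ ⟩
    (((λ i → 1# * f′ i) ⊛ g) n + (θ f′ ⊛ g) n) + (f ⊛ θ g) (suc n)
      ≈⟨ +-congʳ (sym (⊛-distribʳ g _ _ n)) ⟩
    ((λ i → 1# * f′ i + fromℕ i * f′ i) ⊛ g) n + (f ⊛ θ g) (suc n)
      ≈⟨ +-congʳ (⊛-cong (λ i → sym (distribʳ _ _ _)) (λ _ → refl) n) ⟩
    ((λ i → θ f (suc i)) ⊛ g) n + (f ⊛ θ g) (suc n)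
      ≈⟨ +-congʳ (sym (trans (+-congʳ (trans (*-congʳ (zeroˡ _)) (zeroˡ _))) (+-identityˡ _))) ⟩
    (θ f ⊛ g) (suc n) + (f ⊛ θ g) (suc n) ∎
    where
    f′ : ℕ → Carrier
    f′ i = f (suc i)

-- Finite sums and their relation to Cauchy products.

module ListSums {c ℓ} (R : CommutativeRing c ℓ) where
  open CommutativeRing R hiding (zero)
  open Poly R
  open Series R

  module _ {a} {A : Set a} where

    sumL-cong : ∀ {f g : A → Carrier} → (∀ x → f x ≈ g x) → ∀ xs → sumL (map f xs) ≈ sumL (map g xs)
    sumL-cong e []       = refl
    sumL-cong e (x ∷ xs) = +-cong (e x) (sumL-cong e xs)

    sumL-0 : ∀ xs → sumL (map (λ (_ : A) → 0#) xs) ≈ 0#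
    sumL-0 []       = refl
    sumL-0 (x ∷ xs) = trans (+-identityˡ _) (sumL-0 xs)

    sumL-*ˡ : ∀ y (f : A → Carrier) xs → sumL (map (λ x → y * f x) xs) ≈ y * sumL (map f xs)
    sumL-*ˡ y f []       = sym (zeroʳ _)
    sumL-*ˡ y f (x ∷ xs) = trans (+-congˡ (sumL-*ˡ y f xs)) (sym (distribˡ _ _ _))

    sumL-*ʳ : ∀ y (f : A → Carrier) xs → sumL (map f xs) * y ≈ sumL (map (λ x → f x * y) xs)
    sumL-*ʳ y f []       = zeroˡ _
    sumL-*ʳ y f (x ∷ xs) = trans (distribʳ _ _ _) (+-congˡ (sumL-*ʳ y f xs))

    sumL-++ : ∀ (f : A → Carrier) xs ys → sumL (map f (xs ++ ys)) ≈ sumL (map f xs) + sumL (map f ys)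
    sumL-++ f []       ys = sym (+-identityˡ _)
    sumL-++ f (x ∷ xs) ys = trans (+-congˡ (sumL-++ f xs ys)) (sym (+-assoc _ _ _))

    sumL-concatMap : ∀ {b} {B : Set b} (f : A → Carrier) (g : B → List A) ys →
                     sumL (map f (concatMap g ys)) ≈ sumL (map (λ y → sumL (map f (g y))) ys)
    sumL-concatMap f g []       = refl
    sumL-concatMap f g (y ∷ ys) = trans (sumL-++ f (g y) (concatMap g ys)) (+-congˡ (sumL-concatMap f g ys))

    -- Removing an entry `x` from the target `k` shifts the sequence indexed by the target; if `x`
    -- exceeds `k`, nothing qualifies and both sides are zero.
    sumL-shift : ∀ (s : A → ℕ) (f : A → Carrier) xs x k →
      sumL (map (λ v → if x ℕ.+ s v ℕ.≡ᵇ k then f v else 0#) xs)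
        ≈ shift x (λ j → sumL (map (λ v → if s v ℕ.≡ᵇ j then f v else 0#) xs)) k
    sumL-shift s f xs zero    k       = refl
    sumL-shift s f xs (suc x) zero    = sumL-0 xs
    sumL-shift s f xs (suc x) (suc k) = sumL-shift s f xs x k

  shift-cong-≤ : ∀ x {f g} k → (∀ j → j ≤ k → f j ≈ g j) → shift x f k ≈ shift x g k
  shift-cong-≤ zero    k       e = e k ℕₚ.≤-refl
  shift-cong-≤ (suc x) zero    e = refl
  shift-cong-≤ (suc x) (suc k) e = shift-cong-≤ x k (λ j j≤k → e j (ℕₚ.m≤n⇒m≤1+n j≤k))

  sumL-applyUpTo-0 : ∀ {f : ℕ → Carrier} n → (∀ x → f x ≈ 0#) → sumL (applyUpTo f n) ≈ 0#
  sumL-applyUpTo-0 zero    e = refl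
  sumL-applyUpTo-0 (suc n) e = trans (+-cong (e 0) (sumL-applyUpTo-0 n (λ x → e (suc x)))) (+-identityˡ _)

  sumL-applyUpTo-cong : ∀ {f g : ℕ → Carrier} n → (∀ x → x < n → f x ≈ g x) →
                        sumL (applyUpTo f n) ≈ sumL (applyUpTo g n)
  sumL-applyUpTo-cong zero    e = refl
  sumL-applyUpTo-cong (suc n) e =
    +-cong (e 0 (s≤s z≤n)) (sumL-applyUpTo-cong n (λ x x<n → e (suc x) (s≤s x<n)))

  -- `shift x g k` is g(k - x) for x ≤ k and zero beyond, so any bound from `k` on yields the full
  -- convolution.
  sumL-applyUpTo-⊛ : ∀ f g {k b} → k ≤ b →
                     sumL (applyUpTo (λ x → f x * shift x g k) (suc b)) ≈ (f ⊛ g) k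
  sumL-applyUpTo-⊛ f g {zero}  {b}     k≤b       =
    trans (+-congˡ (sumL-applyUpTo-0 b (λ x → zeroʳ _))) (+-identityʳ _)
  sumL-applyUpTo-⊛ f g {suc k} {suc b} (s≤s k≤b) =
    +-congˡ (sumL-applyUpTo-⊛ (λ x → f (suc x)) g k≤b)

  sumL-∷ʳ : ∀ (f : ℕ → Carrier) n → sumL (applyUpTo f (suc n)) ≈ sumL (applyUpTo f n) + f n
  sumL-∷ʳ f zero    = +-comm _ _
  sumL-∷ʳ f (suc n) = trans (+-congˡ (sumL-∷ʳ (λ x → f (suc x)) n)) (sym (+-assoc _ _ _))

-- Sums over boxes of exponent vectors as products of generating functions.

module BoxSums {c ℓ} (R : CommutativeRing c ℓ) (E : ℕ → ℕ → CommutativeRing.Carrier R) where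
  open CommutativeRing R hiding (zero)
  open Poly R
  open Series R
  open ListSums R
  open import Relation.Binary.Reasoning.Setoid setoid

  vecProduct : ∀ {len} → ℕ → Vec ℕ len → Carrier
  vecProduct i []       = 1#
  vecProduct i (r ∷ rs) = E i r * vecProduct (suc i) rs

  boxSum : ℕ → ℕ → ℕ → ℕ → Carrier
  boxSum b len i k = sumL (map (λ v → if sumV v ℕ.≡ᵇ k then vecProduct i v else 0#) (vecsUpTo len b))

  cauchyProduct : ℕ → ℕ → ℕ → Carrier
  cauchyProduct zero      i = monomial 1# 0
  cauchyProduct (suc len) i = E i ⊛ cauchyProduct len (suc i)

  -- Distributivity: expanding the product of the series Σ E i x uˣ picks one entry per factor, and
  -- uᵏ collects the vectors of sum k. No entry of such a vector exceeds k, so the bound `b` loses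
  -- nothing.
  boxSum≈cauchyProduct : ∀ b len i k → k ≤ b → boxSum b len i k ≈ cauchyProduct len i k
  boxSum≈cauchyProduct b zero      i zero    k≤b = +-identityʳ _
  boxSum≈cauchyProduct b zero      i (suc k) k≤b = +-identityʳ _
  boxSum≈cauchyProduct b (suc len) i k       k≤b = begin
    sumL (map term (concatMap (λ x → map (x ∷_) vs) (upTo (suc b))))
      ≈⟨ sumL-concatMap term (λ x → map (x ∷_) vs) (upTo (suc b)) ⟩
    sumL (map (λ x → sumL (map term (map (x ∷_) vs))) (upTo (suc b)))
      ≈⟨ sumL-cong inner (upTo (suc b)) ⟩
    sumL (map (λ x → E i x * shift x (cauchyProduct len (suc i)) k) (upTo (suc b)))
      ≡⟨ ≡.cong sumL (map-upTo _ (suc b)) ⟩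
    sumL (applyUpTo (λ x → E i x * shift x (cauchyProduct len (suc i)) k) (suc b))
      ≈⟨ sumL-applyUpTo-⊛ (E i) (cauchyProduct len (suc i)) k≤b ⟩
    (E i ⊛ cauchyProduct len (suc i)) k ∎
    where
    vs : List (Vec ℕ len)
    vs = vecsUpTo len b

    term : Vec ℕ (suc len) → Carrier
    term v = if sumV v ℕ.≡ᵇ k then vecProduct i v else 0#

    factor : ∀ x (v : Vec ℕ len) → term (x ∷ v)
               ≈ E i x * (if x ℕ.+ sumV v ℕ.≡ᵇ k then vecProduct (suc i) v else 0#)
    factor x v with x ℕ.+ sumV v ℕ.≡ᵇ k
    ... | true  = refl
    ... | false = sym (zeroʳ _)

    inner : ∀ x → sumL (map term (map (x ∷_) vs)) ≈ E i x * shift x (cauchyProduct len (suc i)) k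
    inner x = begin
      sumL (map term (map (x ∷_) vs))
        ≡⟨ ≡.cong sumL (≡.sym (map-∘ vs)) ⟩
      sumL (map (λ v → term (x ∷ v)) vs)
        ≈⟨ sumL-cong (factor x) vs ⟩
      sumL (map (λ v → E i x * (if x ℕ.+ sumV v ℕ.≡ᵇ k then vecProduct (suc i) v else 0#)) vs)
        ≈⟨ sumL-*ˡ (E i x) _ vs ⟩
      E i x * sumL (map (λ v → if x ℕ.+ sumV v ℕ.≡ᵇ k then vecProduct (suc i) v else 0#) vs)
        ≈⟨ *-congˡ (sumL-shift sumV (vecProduct (suc i)) vs x k) ⟩
      E i x * shift x (boxSum b len (suc i)) k
        ≈⟨ *-congˡ (shift-cong-≤ x k (λ j j≤k →
             boxSum≈cauchyProduct b len (suc i) j (ℕₚ.≤-trans j≤k k≤b))) ⟩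
      E i x * shift x (cauchyProduct len (suc i)) k ∎

-- Divided powers and the exponential series.

module DividedPowers {c ℓ} (R : CommutativeRing c ℓ) where
  open CommutativeRing R hiding (zero)
  open Poly R
  open Series R
  open import Algebra.Properties.CommutativeSemigroup *-commutativeSemigroup using (x∙yz≈y∙xz)
  open import Relation.Binary.Reasoning.Setoid setoid

  -- The sequence aᵏ/k!, free of division: for the generating function in u the fields say E(0) = 1
  -- and E′ = aE, that is, E = exp(au).
  record IsDividedPower (E : ℕ → Carrier) (a : Carrier) : Set (c ⊔ ℓ) where
    field
      unit : E 0 ≈ 1#
      step : ∀ k → fromℕ (suc k) * E (suc k) ≈ a * E k

  open IsDividedPower

  isDividedPower-1 : IsDividedPower (monomial 1# 0) 0#
  isDividedPower-1 .unit   = refl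
  isDividedPower-1 .step k = trans (zeroʳ _) (sym (zeroˡ _))

  θ-⊛-step : ∀ {E a} → IsDividedPower E a → ∀ g k → (θ E ⊛ g) (suc k) ≈ a * (E ⊛ g) k
  θ-⊛-step {E} {a} d g k = begin
    0# * E 0 * g (suc k) + ((λ i → θ E (suc i)) ⊛ g) k
      ≈⟨ +-cong (trans (*-congʳ (zeroˡ _)) (zeroˡ _)) (⊛-cong (step d) (λ _ → refl) k) ⟩
    0# + ((λ i → a * E i) ⊛ g) k ≈⟨ +-identityˡ _ ⟩
    ((λ i → a * E i) ⊛ g) k      ≈⟨ ⊛-scaleˡ a E g k ⟩
    a * (E ⊛ g) k                ∎

  -- exp(au) exp(bu) = exp((a+b)u), from the product rule for `θ` in place of the binomial theorem.
  isDividedPower-+ : ∀ {E F a b} → IsDividedPower E a → IsDividedPower F b → IsDividedPower (E ⊛ F) (a + b)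
  isDividedPower-+ d e .unit = trans (*-cong (unit d) (unit e)) (*-identityˡ _)
  isDividedPower-+ {E} {F} {a} {b} d e .step k = begin
    θ (E ⊛ F) (suc k)                          ≈⟨ θ-⊛ E F (suc k) ⟩
    (θ E ⊛ F) (suc k) + (E ⊛ θ F) (suc k)      ≈⟨ +-congˡ (⊛-comm E (θ F) (suc k)) ⟩
    (θ E ⊛ F) (suc k) + (θ F ⊛ E) (suc k)      ≈⟨ +-cong (θ-⊛-step d F k) (θ-⊛-step e E k) ⟩
    a * (E ⊛ F) k + b * (F ⊛ E) k              ≈⟨ +-congˡ (*-congˡ (⊛-comm F E k)) ⟩
    a * (E ⊛ F) k + b * (E ⊛ F) k              ≈⟨ sym (distribʳ _ _ _) ⟩
    (a + b) * (E ⊛ F) k                        ∎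

  module _ (inv : ℕ → Carrier) (inverse : ∀ n → fromℕ (suc n) * inv n ≈ 1#) where

    dividedPower : Carrier → ℕ → Carrier
    dividedPower a zero    = 1#
    dividedPower a (suc k) = inv k * (a * dividedPower a k)

    inv-cancel : ∀ k x → inv k * (fromℕ (suc k) * x) ≈ x
    inv-cancel k x = begin
      inv k * (fromℕ (suc k) * x) ≈⟨ sym (*-assoc _ _ _) ⟩
      inv k * fromℕ (suc k) * x   ≈⟨ *-congʳ (trans (*-comm _ _) (inverse k)) ⟩
      1# * x                      ≈⟨ *-identityˡ _ ⟩
      x                           ∎

    dividedPower-step : ∀ a k → fromℕ (suc k) * dividedPower a (suc k) ≈ a * dividedPower a k
    dividedPower-step a k = trans (x∙yz≈y∙xz _ _ _) (inv-cancel k _)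

    -- Invertibility of k + 1 lets the recurrence determine the sequence. A product of exponentials
    -- is thereby identified with the divided powers of a sum.
    dividedPower-unique : ∀ {E a} → IsDividedPower E a → ∀ k → E k ≈ dividedPower a k
    dividedPower-unique d zero    = unit d
    dividedPower-unique {E} {a} d (suc k) = begin
      E (suc k)                           ≈⟨ sym (inv-cancel k _) ⟩
      inv k * (fromℕ (suc k) * E (suc k)) ≈⟨ *-congˡ (step d k) ⟩
      inv k * (a * E k)                   ≈⟨ *-congˡ (*-congˡ (dividedPower-unique d k)) ⟩
      dividedPower a (suc k)              ∎

-- Divisibility of factorials behind the integrality of the Bell coefficients.

m!n!∣[m+n]! : ∀ m n → m ! ℕ.* n ! ∣ (m ℕ.+ n) !
m!n!∣[m+n]! m n = ≡.subst (λ k → m ! ℕ.* k ! ∣ (m ℕ.+ n) !) (ℕₚ.m+n∸m≡n m n)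
                    (k![n∸k]!∣n! (ℕₚ.m≤m+n m n))

-- With i = p + 1 and q = ir, the induction step needs (r+1) i! q! to divide (i+q)!. Here (r+1) i! =
-- (i+q) p!, and p! q! divides (p+q)!. Positive i matters: r! does not divide 0! for r ≥ 2.
r!i!^r∣[ir]! : ∀ p r → r ! ℕ.* (suc p !) ℕ.^ r ∣ (suc p ℕ.* r) !
r!i!^r∣[ir]! p zero    = ∣-reflexive (≡.cong _! (≡.sym (ℕₚ.*-zeroʳ p)))
r!i!^r∣[ir]! p (suc r) = ≡.subst (λ k → suc r ! ℕ.* (suc p !) ℕ.^ suc r ∣ k !) (≡.sym (ℕₚ.*-suc (suc p) r))
  (∣-trans (∣-reflexive regroup)
    (∣-trans (*-pres-∣ (∣-refl {suc r ℕ.* suc p !}) (r!i!^r∣[ir]! p r))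
      (∣-trans (∣-reflexive regroup′) (*-pres-∣ (∣-reflexive (ℕₚ.*-suc (suc p) r)) (m!n!∣[m+n]! p q)))))
  where
  open +-*-Solver
  q : ℕ
  q = suc p ℕ.* r

  regroup : suc r ! ℕ.* (suc p !) ℕ.^ suc r ≡ suc r ℕ.* suc p ! ℕ.* (r ! ℕ.* (suc p !) ℕ.^ r)
  regroup = solve 4 (λ a b x y → a :* b :* (x :* y) := a :* x :* (b :* y)) ≡.refl
              (suc r) (r !) (suc p !) ((suc p !) ℕ.^ r)

  regroup′ : suc r ℕ.* suc p ! ℕ.* q ! ≡ suc p ℕ.* suc r ℕ.* (p ! ℕ.* q !)
  regroup′ = solve 4 (λ a b x y → a :* (b :* x) :* y := b :* a :* (x :* y)) ≡.refl (suc r) (suc p) (p !) (q !)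

-- It makes the truncating division in `bellCoef` exact.
denomFrom∣wsumFrom! : ∀ {len} p (v : Vec ℕ len) → denomFrom (suc p) v ∣ wsumFrom (suc p) v !
denomFrom∣wsumFrom! p []       = ∣-refl
denomFrom∣wsumFrom! p (r ∷ rs) = ∣-trans
  (*-pres-∣ (r!i!^r∣[ir]! p r) (denomFrom∣wsumFrom! (suc p) rs))
  (m!n!∣[m+n]! (suc p ℕ.* r) (wsumFrom (suc (suc p)) rs))

-- Inverse factorials and natural powers in the ring.

module Factorials {c ℓ} (R : CommutativeRing c ℓ) (inv : ℕ → CommutativeRing.Carrier R)
  (inverse : ∀ n → MutuallyInverse R (Poly.fromℕ R (suc n)) (inv n)) where
  open CommutativeRing R hiding (zero)
  open Poly R
  open WithInverses inv
  open RingHom R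
  open import Algebra.Properties.CommutativeSemigroup *-commutativeSemigroup using (interchange)
  open import Relation.Binary.Reasoning.Setoid setoid

  !-invFact : ∀ n → fromℕ (n !) * invFact n ≈ 1#
  !-invFact zero    = trans (*-identityʳ _) (+-identityʳ _)
  !-invFact (suc n) = begin
    fromℕ (suc n ℕ.* n !) * (inv n * invFact n)         ≈⟨ *-congʳ (fromℕ-* (suc n) (n !)) ⟩
    fromℕ (suc n) * fromℕ (n !) * (inv n * invFact n)   ≈⟨ interchange _ _ _ _ ⟩
    fromℕ (suc n) * inv n * (fromℕ (n !) * invFact n)   ≈⟨ *-cong (inverse n) (!-invFact n) ⟩
    1# * 1#                                             ≈⟨ *-identityˡ _ ⟩
    1#                                                  ∎

  invFact-cancel : ∀ n {x y} → x * invFact n ≈ y * invFact n → x ≈ y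
  invFact-cancel n {x} {y} e = trans (sym (undo x)) (trans (*-congʳ e) (undo y))
    where
    undo : ∀ z → z * invFact n * fromℕ (n !) ≈ z
    undo z = trans (*-assoc _ _ _) (trans (*-congˡ (trans (*-comm _ _) (!-invFact n))) (*-identityʳ _))

  ^-cong : ∀ n {x y} → x ≈ y → x ^ n ≈ y ^ n
  ^-cong zero    e = refl
  ^-cong (suc n) e = *-cong e (^-cong n e)

  ^-distrib-* : ∀ x y n → (x * y) ^ n ≈ x ^ n * y ^ n
  ^-distrib-* x y zero    = sym (*-identityˡ _)
  ^-distrib-* x y (suc n) = trans (*-congˡ (^-distrib-* x y n)) (interchange _ _ _ _)

  fromℕ-^ : ∀ m n → fromℕ (m ℕ.^ n) ≈ fromℕ m ^ n
  fromℕ-^ m zero    = +-identityʳ _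
  fromℕ-^ m (suc n) = trans (fromℕ-* m (m ℕ.^ n)) (*-congˡ (fromℕ-^ m n))

-- Bell polynomials as coefficients of divided powers.

module BellSeries {c ℓ} (R : CommutativeRing c ℓ) (inv : ℕ → CommutativeRing.Carrier R)
  (inverse : ∀ n → MutuallyInverse R (Poly.fromℕ R (suc n)) (inv n))
  (X : ℕ → CommutativeRing.Carrier R) where
  open CommutativeRing R hiding (zero)
  open Poly R
  open WithInverses inv
  open RingHom R
  open Factorials R inv inverse
  open Series R
  open ListSums R
  open import Algebra.Solver.Ring.NaturalCoefficients.Default commutativeSemiring
    using (solve; _:=_; _:*_)
  open import Relation.Binary.Reasoning.Setoid setoid

  private
    S : CommutativeRing c ℓ
    S = seriesRing
    module S = CommutativeRing S
    module SP = Poly S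

  open DividedPowers S

  invS : ℕ → S.Carrier
  invS n = monomial (inv n) 0

  inverseS : ∀ n → SP.fromℕ (suc n) S.* invS n S.≈ S.1#
  inverseS n m = begin
    (SP.fromℕ (suc n) ⊛ monomial (inv n) 0) m               ≈⟨ ⊛-cong (fromℕ-series (suc n)) (λ _ → refl) m ⟩
    (monomial (fromℕ (suc n)) 0 ⊛ monomial (inv n) 0) m     ≈⟨ monomial-* _ 0 _ 0 m ⟩
    monomial (fromℕ (suc n) * inv n) 0 m                    ≈⟨ monomial-cong (inverse n) 0 m ⟩
    monomial 1# 0 m                                         ∎

  egf : ℕ → Carrier
  egf i = X i * invFact i

  coeffPower : ℕ → ℕ → Carrier
  coeffPower i x = egf i ^ x * invFact x

  -- The x-th divided power of the single term Xᵢ tⁱ/i!. The index `x` counts towards Σ rᵢ, the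
  -- exponent of t towards Σ i rᵢ.
  termPower : ℕ → ℕ → S.Carrier
  termPower i x = monomial (coeffPower i x) (i ℕ.* x)

  termPower-isDividedPower : ∀ i → IsDividedPower (termPower i) (monomial (egf i) i)
  termPower-isDividedPower i .IsDividedPower.unit n = begin
    monomial (1# * 1#) (i ℕ.* 0) n   ≡⟨ ≡.cong (λ p → monomial (1# * 1#) p n) (ℕₚ.*-zeroʳ i) ⟩
    monomial (1# * 1#) 0 n           ≈⟨ monomial-cong (*-identityˡ _) 0 n ⟩
    monomial 1# 0 n                  ∎
  termPower-isDividedPower i .IsDividedPower.step k n = begin
    (SP.fromℕ (suc k) ⊛ termPower i (suc k)) n
      ≈⟨ ⊛-cong (fromℕ-series (suc k)) (λ _ → refl) n ⟩
    (monomial (fromℕ (suc k)) 0 ⊛ termPower i (suc k)) n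
      ≈⟨ monomial-* _ 0 _ (i ℕ.* suc k) n ⟩
    monomial (fromℕ (suc k) * coeffPower i (suc k)) (i ℕ.* suc k) n
      ≈⟨ monomial-cong scalar (i ℕ.* suc k) n ⟩
    monomial (egf i * coeffPower i k) (i ℕ.* suc k) n
      ≡⟨ ≡.cong (λ p → monomial (egf i * coeffPower i k) p n) (ℕₚ.*-suc i k) ⟩
    monomial (egf i * coeffPower i k) (i ℕ.+ i ℕ.* k) n
      ≈⟨ sym (monomial-* _ i _ (i ℕ.* k) n) ⟩
    (monomial (egf i) i ⊛ termPower i k) n ∎
    where
    scalar : fromℕ (suc k) * coeffPower i (suc k) ≈ egf i * coeffPower i k
    scalar = trans
      (solve 5 (λ s z y t u → s :* (z :* y :* (t :* u)) := s :* t :* (z :* (y :* u))) refl _ _ _ _ _)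
      (trans (*-congʳ (inverse k)) (*-identityˡ _))

  open BoxSums S termPower
  open BoxSums R coeffPower using () renaming (vecProduct to coeffProduct)

  -- The terms of degree i, …, i+len-1 of Σ Xⱼ tʲ/j!; Bell n k involves only those of degree 1, …, n.
  window : ℕ → ℕ → S.Carrier
  window zero      i = S.0#
  window (suc len) i = monomial (egf i) i S.+ window len (suc i)

  -- The multinomial theorem in divided form: a product of exponentials of single terms is the
  -- exponential of their sum.
  cauchyProduct-isDividedPower : ∀ len i → IsDividedPower (cauchyProduct len i) (window len i)
  cauchyProduct-isDividedPower zero      i = isDividedPower-1
  cauchyProduct-isDividedPower (suc len) i =
    isDividedPower-+ (termPower-isDividedPower i) (cauchyProduct-isDividedPower len (suc i))

  window-below : ∀ len i n → n < i → window len i n ≈ 0#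
  window-below zero      i n n<i = refl
  window-below (suc len) i n n<i = trans
    (+-cong (monomial-other _ (λ e → ℕₚ.<-irrefl (≡.sym e) n<i)) (window-below len (suc i) n (ℕₚ.m≤n⇒m≤1+n n<i)))
    (+-identityˡ _)

  window-inside : ∀ len i n → i ≤ n → n < i ℕ.+ len → window len i n ≈ egf n
  window-inside zero      i n i≤n n<i+len =
    ⊥-elim (ℕₚ.<-irrefl ≡.refl (ℕₚ.<-≤-trans n<i+len (ℕₚ.≤-trans (ℕₚ.≤-reflexive (ℕₚ.+-identityʳ i)) i≤n)))
  window-inside (suc len) i n i≤n n<i+len with i ℕ.≟ n
  ... | yes ≡.refl = trans (+-cong (monomial-self _ i) (window-below len (suc i) i ℕₚ.≤-refl)) (+-identityʳ _)
  ... | no  i≢n    = trans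
    (+-cong (monomial-other _ i≢n)
      (window-inside len (suc i) n (ℕₚ.≤∧≢⇒< i≤n i≢n) (≡.subst (n <_) (ℕₚ.+-suc i len) n<i+len)))
    (+-identityˡ _)

  tail : S.Carrier
  tail zero    = 0#
  tail (suc n) = egf (suc n)

  window≈tail : ∀ n i → i ≤ n → window n 1 i ≈ tail i
  window≈tail n zero    i≤n = window-below n 1 0 (s≤s z≤n)
  window≈tail n (suc i) i≤n = window-inside n 1 (suc i) (s≤s z≤n) (s≤s i≤n)

  dividedPowerS : S.Carrier → ℕ → S.Carrier
  dividedPowerS = dividedPower invS inverseS

  dividedPower-cong-≤ : ∀ {a b} n → (∀ i → i ≤ n → a i ≈ b i) →
                        ∀ k i → i ≤ n → dividedPowerS a k i ≈ dividedPowerS b k i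
  dividedPower-cong-≤ n e zero    i i≤n = refl
  dividedPower-cong-≤ n e (suc k) i i≤n = ⊛-cong-≤ i (λ _ _ → refl) (λ j j≤i →
    ⊛-cong-≤ j (λ l l≤j → e l (ℕₚ.≤-trans l≤j (ℕₚ.≤-trans j≤i i≤n)))
               (λ l l≤j → dividedPower-cong-≤ n e k l (ℕₚ.≤-trans l≤j (ℕₚ.≤-trans j≤i i≤n))))

  -- `tail` has no constant term, so its k-th power is divisible by tᵏ. This makes the binomial
  -- series in `tail` finite in each degree.
  dividedPower-order : ∀ k n → n < k → dividedPowerS tail k n ≈ 0#
  dividedPower-order (suc k) n n<1+k = begin
    (invS k ⊛ (tail ⊛ dividedPowerS tail k)) n   ≈⟨ monomial-⊛ (inv k) 0 _ n ⟩
    inv k * (tail ⊛ dividedPowerS tail k) n      ≈⟨ *-congˡ (vanish n n<1+k) ⟩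
    inv k * 0#                                   ≈⟨ zeroʳ _ ⟩
    0#                                           ∎
    where
    vanish : ∀ n → n < suc k → (tail ⊛ dividedPowerS tail k) n ≈ 0#
    vanish zero    _         = zeroˡ _
    vanish (suc n) (s≤s n<k) = trans (+-cong (zeroˡ _) (begin
      ((λ i → tail (suc i)) ⊛ dividedPowerS tail k) n
        ≈⟨ ⊛-cong-≤ n (λ _ _ → refl) (λ i i≤n → dividedPower-order k i (ℕₚ.≤-<-trans i≤n n<k)) ⟩
      ((λ i → tail (suc i)) ⊛ (λ _ → 0#)) n   ≈⟨ ⊛-comm _ _ n ⟩
      ((λ _ → 0#) ⊛ (λ i → tail (suc i))) n   ≈⟨ ⊛-zeroˡ _ n ⟩
      0#                                      ∎)) (+-identityˡ _)

  vecProduct≈monomial : ∀ {len} i (v : Vec ℕ len) n →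
                        vecProduct i v n ≈ monomial (coeffProduct i v) (wsumFrom i v) n
  vecProduct≈monomial i []       n = refl
  vecProduct≈monomial i (r ∷ rs) n = trans (⊛-cong (λ _ → refl) (vecProduct≈monomial (suc i) rs) n)
                                           (monomial-* _ (i ℕ.* r) _ _ n)

  denom-coeffProduct : ∀ {len} i (v : Vec ℕ len) → fromℕ (denomFrom i v) * coeffProduct i v ≈ monoFrom X i v
  denom-coeffProduct i []       = trans (*-identityʳ _) (+-identityʳ _)
  denom-coeffProduct i (r ∷ rs) = begin
    fromℕ (r ! ℕ.* (i !) ℕ.^ r ℕ.* denomFrom (suc i) rs) * (coeffPower i r * coeffProduct (suc i) rs)
      ≈⟨ *-congʳ (trans (fromℕ-* (r ! ℕ.* (i !) ℕ.^ r) _) (*-congʳ (fromℕ-* (r !) ((i !) ℕ.^ r)))) ⟩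
    fromℕ (r !) * fromℕ ((i !) ℕ.^ r) * fromℕ (denomFrom (suc i) rs) * (coeffPower i r * coeffProduct (suc i) rs)
      ≈⟨ *-congʳ (*-congʳ (*-congˡ (fromℕ-^ (i !) r))) ⟩
    fromℕ (r !) * fromℕ (i !) ^ r * fromℕ (denomFrom (suc i) rs) * (egf i ^ r * invFact r * coeffProduct (suc i) rs)
      ≈⟨ solve 6 (λ a b d z f p → a :* b :* d :* (z :* f :* p) := a :* f :* (b :* z) :* (d :* p)) refl _ _ _ _ _ _ ⟩
    fromℕ (r !) * invFact r * (fromℕ (i !) ^ r * egf i ^ r) * (fromℕ (denomFrom (suc i) rs) * coeffProduct (suc i) rs)
      ≈⟨ *-cong (trans (*-cong (!-invFact r) (sym (^-distrib-* _ _ r))) (*-identityˡ _))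
                (denom-coeffProduct (suc i) rs) ⟩
    (fromℕ (i !) * (X i * invFact i)) ^ r * monoFrom X (suc i) rs
      ≈⟨ *-congʳ (^-cong r (trans (solve 3 (λ a x f → a :* (x :* f) := a :* f :* x) refl _ _ _)
           (trans (*-congʳ (!-invFact i)) (*-identityˡ _)))) ⟩
    X i ^ r * monoFrom X (suc i) rs ∎

  bellCoef-coeffProduct : ∀ {len} n (v : Vec ℕ len) → wsumFrom 1 v ≡ n →
    fromℕ (bellCoef n v) * monoFrom X 1 v * invFact n ≈ coeffProduct 1 v
  bellCoef-coeffProduct n v ≡.refl = begin
    fromℕ (bellCoef n v) * monoFrom X 1 v * invFact n
      ≈⟨ *-congʳ (*-congˡ (sym (denom-coeffProduct 1 v))) ⟩
    fromℕ (bellCoef n v) * (fromℕ (denomFrom 1 v) * coeffProduct 1 v) * invFact n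
      ≈⟨ solve 4 (λ a b p f → a :* (b :* p) :* f := a :* b :* f :* p) refl _ _ _ _ ⟩
    fromℕ (bellCoef n v) * fromℕ (denomFrom 1 v) * invFact n * coeffProduct 1 v
      ≈⟨ *-congʳ (*-congʳ (sym (fromℕ-* (bellCoef n v) (denomFrom 1 v)))) ⟩
    fromℕ (bellCoef n v ℕ.* denomFrom 1 v) * invFact n * coeffProduct 1 v
      ≡⟨ ≡.cong (λ k → fromℕ k * invFact n * coeffProduct 1 v)
           (m/n*n≡m {{denomFrom-nz 1 v}} (denomFrom∣wsumFrom! 0 v)) ⟩
    fromℕ (n !) * invFact n * coeffProduct 1 v
      ≈⟨ trans (*-congʳ (!-invFact n)) (*-identityˡ _) ⟩
    coeffProduct 1 v ∎

  sumL-coeff : ∀ {a} {A : Set a} (f : A → S.Carrier) xs n → SP.sumL (map f xs) n ≈ sumL (map (λ x → f x n) xs)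
  sumL-coeff f []       n = refl
  sumL-coeff f (x ∷ xs) n = +-congˡ (sumL-coeff f xs n)

  -- The two conditions of the Bell sum are enforced separately: Σ rᵢ = k by the index of the
  -- divided power, Σ i rᵢ = n by taking the coefficient of tⁿ.
  Bell-invFact : ∀ n k → k ≤ n → Bell n k X * invFact n ≈ dividedPowerS tail k n
  Bell-invFact n k k≤n = begin
    Bell n k X * invFact n
      ≈⟨ sumL-*ʳ (invFact n) _ (vecsUpTo n n) ⟩
    sumL (map _ (vecsUpTo n n))
      ≈⟨ sumL-cong term≈ (vecsUpTo n n) ⟩
    sumL (map (λ v → (if sumV v ℕ.≡ᵇ k then vecProduct 1 v else S.0#) n) (vecsUpTo n n))
      ≈⟨ sym (sumL-coeff _ (vecsUpTo n n) n) ⟩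
    boxSum n n 1 k n
      -- Entries range over 0, ..., n; `k≤n` is what makes this box large enough.
      ≈⟨ boxSum≈cauchyProduct n n 1 k k≤n n ⟩
    cauchyProduct n 1 k n
      ≈⟨ dividedPower-unique invS inverseS (cauchyProduct-isDividedPower n 1) k n ⟩
    dividedPowerS (window n 1) k n
      ≈⟨ dividedPower-cong-≤ n (window≈tail n) k n ℕₚ.≤-refl ⟩
    dividedPowerS tail k n ∎
    where
    term≈ : ∀ v → (if (sumV v ℕ.≡ᵇ k) ∧ (wsumFrom 1 v ℕ.≡ᵇ n)
                   then fromℕ (bellCoef n v) * monoFrom X 1 v else 0#) * invFact n
                  ≈ (if sumV v ℕ.≡ᵇ k then vecProduct 1 v else S.0#) n
    term≈ v with sumV v ℕ.≡ᵇ k | wsumFrom 1 v ℕ.≡ᵇ n in eq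
    ... | false | _     = zeroˡ _
    ... | true  | true  = trans (bellCoef-coeffProduct n v w≡n) (sym (trans (vecProduct≈monomial 1 v n)
        (trans (reflexive (≡.cong (λ p → monomial (coeffProduct 1 v) p n) w≡n)) (monomial-self _ n))))
      where
      w≡n : wsumFrom 1 v ≡ n
      w≡n = ℕₚ.≡ᵇ⇒≡ _ _ (≡.subst T (≡.sym eq) _)
    ... | true  | false = trans (zeroˡ _) (sym (trans (vecProduct≈monomial 1 v n)
        (monomial-other _ {wsumFrom 1 v} {n} (λ e → ≡.subst T eq (ℕₚ.≡⇒≡ᵇ _ _ e)))))

-- Falling factorials and integer powers of a unit.

module Falling {c ℓ} (R : CommutativeRing c ℓ) where
  open CommutativeRing R hiding (zero)
  open Poly R

  1+r-[1+j]≡r-j : ∀ r j → ℤ.suc r ℤ.- + suc j ≡ r ℤ.- + j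
  1+r-[1+j]≡r-j r j = solve 2 (λ r j → (con (+ 1) :+ r) :- (con (+ 1) :+ j) := r :- j) ≡.refl r (+ j)
    where open ℤ-Solver

  fall-suc : ∀ r j → fall (ℤ.suc r) (suc j) ≡ ℤ.suc r ℤ.* fall r j
  fall-suc r zero    =
    solve 1 (λ r → con (+ 1) :* ((con (+ 1) :+ r) :- con (+ 0)) := (con (+ 1) :+ r) :* con (+ 1)) ≡.refl r
    where open ℤ-Solver
  fall-suc r (suc j) = ≡.trans (≡.cong₂ ℤ._*_ (fall-suc r j) (1+r-[1+j]≡r-j r j))
                               (ℤₚ.*-assoc (ℤ.suc r) (fall r j) (r ℤ.- + j))

  -- Pascal's rule multiplied by (j+1)!; it drives the passage from r to r + 1 in the binomial
  -- series.
  fall-pascal : ∀ r j → fall (ℤ.suc r) (suc j) ≡ fall r (suc j) ℤ.+ + suc j ℤ.* fall r j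
  fall-pascal r j = ≡.trans (fall-suc r j)
    (solve 3 (λ r j f → (con (+ 1) :+ r) :* f := f :* (r :- j) :+ (con (+ 1) :+ j) :* f) ≡.refl r (+ j) (fall r j))
    where open ℤ-Solver

  fall-0 : ∀ j → fall (+ 0) (suc j) ≡ + 0
  fall-0 zero    = ≡.refl
  fall-0 (suc j) = ≡.cong (ℤ._* (+ 0 ℤ.- + suc j)) (fall-0 j)

  -- The induction lowers `j` and raises `e` with their sum fixed: the last factor of the falling
  -- factorial is e + 1 and is absorbed into the factorial.
  fall-! : ∀ j e → fall (+ (j ℕ.+ e)) j ℤ.* + (e !) ≡ + ((j ℕ.+ e) !)
  fall-! zero    e = ℤₚ.*-identityˡ _
  fall-! (suc j) e = begin
    fall (+ (suc j ℕ.+ e)) j ℤ.* (+ (suc j ℕ.+ e) ℤ.- + j) ℤ.* + (e !)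
      ≡⟨ ≡.cong (λ k → fall (+ k) j ℤ.* (+ k ℤ.- + j) ℤ.* + (e !)) (≡.sym (ℕₚ.+-suc j e)) ⟩
    fall (+ (j ℕ.+ suc e)) j ℤ.* (+ (j ℕ.+ suc e) ℤ.- + j) ℤ.* + (e !)
      ≡⟨ solve 4 (λ f j e x → f :* ((j :+ e) :- j) :* x := f :* (e :* x)) ≡.refl
           (fall (+ (j ℕ.+ suc e)) j) (+ j) (+ suc e) (+ (e !)) ⟩
    fall (+ (j ℕ.+ suc e)) j ℤ.* (+ suc e ℤ.* + (e !))
      ≡⟨ ≡.cong (fall (+ (j ℕ.+ suc e)) j ℤ.*_) (≡.sym (ℤₚ.pos-* (suc e) (e !))) ⟩
    fall (+ (j ℕ.+ suc e)) j ℤ.* + (suc e !)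
      ≡⟨ fall-! j (suc e) ⟩
    + ((j ℕ.+ suc e) !)
      ≡⟨ ≡.cong (λ k → + (k !)) (ℕₚ.+-suc j e) ⟩
    + ((suc j ℕ.+ e) !) ∎
    where
    open ≡.≡-Reasoning
    open ℤ-Solver

  module _ {z zinv : Carrier} (unit : z * zinv ≈ 1#) where

    -- For negative r, `unit` removes one factor `zinv`. The binomial series can thus be treated
    -- without regard to the sign of its exponent.
    zpow-suc : ∀ r → zpow z zinv (ℤ.suc r) ≈ z * zpow z zinv r
    zpow-suc (+ n)        = refl
    zpow-suc -[1+ zero ]  = sym (trans (*-congˡ (*-identityʳ _)) unit)
    zpow-suc -[1+ suc n ] = sym (trans (sym (*-assoc _ _ _)) (trans (*-congʳ unit) (*-identityˡ _)))

-- Potential polynomials as coefficients of integer powers of a series.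

module Potential {c ℓ} (R : CommutativeRing c ℓ) (inv : ℕ → CommutativeRing.Carrier R)
  (inverse : ∀ n → MutuallyInverse R (Poly.fromℕ R (suc n)) (inv n))
  (Z : ℕ → CommutativeRing.Carrier R) (z0inv : CommutativeRing.Carrier R)
  (unit : MutuallyInverse R (Z 0) z0inv) where
  open CommutativeRing R hiding (zero)
  open Poly R
  open WithInverses inv
  open RingHom R
  open Falling R
  open Series R
  open ListSums R
  open BellSeries R inv inverse Z public using (egf)
  open BellSeries R inv inverse Z hiding (egf)
  open DividedPowers seriesRing using (dividedPower-step)
  open import Algebra.Solver.Ring.NaturalCoefficients.Default commutativeSemiring
    using (solve; _:=_; _:+_; _:*_)
  open import Relation.Binary.Reasoning.Setoid setoid

  tailPower : ℕ → ℕ → Carrier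
  tailPower = dividedPowerS tail

  potential : ℤ → ℕ → Carrier
  potential r m = Phat (+ m) r Z z0inv * invFact m

  coeff : ℤ → ℕ → Carrier
  coeff r j = fromℤ (fall r j) * zpow (Z 0) z0inv (r ℤ.- + j)

  -- Multiplying the j-th term of the binomial series by `tail` gives (j+1) `coeff r j` times the
  -- (j+1)-st divided power. `carry r j` is the contribution that arrives at index j.
  carry : ℤ → ℕ → Carrier
  carry r zero    = 0#
  carry r (suc j) = fromℕ (suc j) * coeff r j

  coeff-suc : ∀ r j → coeff (ℤ.suc r) j ≈ Z 0 * coeff r j + carry r j
  coeff-suc r zero    = begin
    fromℕ 1 * zpow (Z 0) z0inv (ℤ.suc r ℤ.- + 0)
      ≡⟨ ≡.cong (λ s → fromℕ 1 * zpow (Z 0) z0inv s) (ℤₚ.+-assoc (+ 1) r (+ 0)) ⟩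
    fromℕ 1 * zpow (Z 0) z0inv (ℤ.suc (r ℤ.- + 0))
      ≈⟨ *-congˡ (zpow-suc unit (r ℤ.- + 0)) ⟩
    fromℕ 1 * (Z 0 * zpow (Z 0) z0inv (r ℤ.- + 0))
      ≈⟨ solve 3 (λ a z p → a :* (z :* p) := z :* (a :* p)) refl _ _ _ ⟩
    Z 0 * coeff r 0
      ≈⟨ sym (+-identityʳ _) ⟩
    Z 0 * coeff r 0 + 0# ∎
  coeff-suc r (suc j) = begin
    fromℤ (fall (ℤ.suc r) (suc j)) * zpow (Z 0) z0inv (ℤ.suc r ℤ.- + suc j)
      ≡⟨ ≡.cong₂ (λ a s → fromℤ a * zpow (Z 0) z0inv s) (fall-pascal r j) (1+r-[1+j]≡r-j r j) ⟩
    fromℤ (fall r (suc j) ℤ.+ + suc j ℤ.* fall r j) * zpow (Z 0) z0inv (r ℤ.- + j)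
      ≈⟨ *-congʳ (trans (fromℤ-+ (fall r (suc j)) _) (+-congˡ (fromℤ-* (+ suc j) (fall r j)))) ⟩
    (fromℤ (fall r (suc j)) + fromℕ (suc j) * fromℤ (fall r j)) * zpow (Z 0) z0inv (r ℤ.- + j)
      ≈⟨ solve 4 (λ a s b p → (a :+ s :* b) :* p := a :* p :+ s :* (b :* p)) refl _ _ _ _ ⟩
    fromℤ (fall r (suc j)) * zpow (Z 0) z0inv (r ℤ.- + j) + carry r (suc j)
      ≈⟨ +-congʳ (*-congˡ lower) ⟩
    fromℤ (fall r (suc j)) * (Z 0 * zpow (Z 0) z0inv (r ℤ.- + suc j)) + carry r (suc j)
      ≈⟨ +-congʳ (solve 3 (λ a z p → a :* (z :* p) := z :* (a :* p)) refl _ _ _) ⟩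
    Z 0 * coeff r (suc j) + carry r (suc j) ∎
    where
    lower : zpow (Z 0) z0inv (r ℤ.- + j) ≈ Z 0 * zpow (Z 0) z0inv (r ℤ.- + suc j)
    lower = begin
      zpow (Z 0) z0inv (r ℤ.- + j)                 ≡⟨ ≡.cong (zpow (Z 0) z0inv) (≡.sym (1+r-[1+j]≡r-j r j)) ⟩
      zpow (Z 0) z0inv (ℤ.suc r ℤ.- + suc j)       ≡⟨ ≡.cong (zpow (Z 0) z0inv) (ℤₚ.+-assoc (+ 1) r (ℤ.- + suc j)) ⟩
      zpow (Z 0) z0inv (ℤ.suc (r ℤ.- + suc j))     ≈⟨ zpow-suc unit (r ℤ.- + suc j) ⟩
      Z 0 * zpow (Z 0) z0inv (r ℤ.- + suc j)       ∎

  -- The binomial series (Z₀ + tail)ʳ truncated after N terms.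
  partialSum : ℤ → ℕ → ℕ → Carrier
  partialSum r N m = sumL (applyUpTo (λ j → coeff r j * tailPower j m) N)

  partialSum-stable : ∀ r m d → partialSum r (d ℕ.+ suc m) m ≈ partialSum r (suc m) m
  partialSum-stable r m zero    = refl
  partialSum-stable r m (suc d) = begin
    partialSum r (suc N) m
      ≈⟨ sumL-∷ʳ _ N ⟩
    partialSum r N m + coeff r N * tailPower N m
      ≈⟨ +-cong (partialSum-stable r m d)
                (trans (*-congˡ (dividedPower-order N m (ℕₚ.m≤n+m (suc m) d))) (zeroʳ _)) ⟩
    partialSum r (suc m) m + 0#
      ≈⟨ +-identityʳ _ ⟩
    partialSum r (suc m) m ∎
    where
    N : ℕ
    N = d ℕ.+ suc m

  -- `Phat` cuts the series at j = m, a bound that varies with the degree, while a product with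
  -- `egf` mixes all degrees up to m. One common `N` can serve them all.
  potential≈partialSum : ∀ r m N → m < N → potential r m ≈ partialSum r N m
  potential≈partialSum r m N m<N = begin
    potential r m
      ≈⟨ sumL-*ʳ (invFact m) _ (upTo (suc m)) ⟩
    sumL (map (λ j → coeff r j * Bell m j Z * invFact m) (upTo (suc m)))
      ≡⟨ ≡.cong sumL (map-upTo _ (suc m)) ⟩
    sumL (applyUpTo (λ j → coeff r j * Bell m j Z * invFact m) (suc m))
      ≈⟨ sumL-applyUpTo-cong (suc m) (λ { j (s≤s j≤m) →
           trans (*-assoc (coeff r j) (Bell m j Z) (invFact m)) (*-congˡ (Bell-invFact m j j≤m)) }) ⟩
    partialSum r (suc m) m
      ≈⟨ sym (partialSum-stable r m (N ℕ.∸ suc m)) ⟩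
    partialSum r (N ℕ.∸ suc m ℕ.+ suc m) m
      ≡⟨ ≡.cong (λ k → partialSum r k m) (ℕₚ.m∸n+n≡m m<N) ⟩
    partialSum r N m ∎

  egf≈ : ∀ n → egf n ≈ monomial (Z 0) 0 n + tail n
  egf≈ zero    = trans (*-identityʳ _) (sym (+-identityʳ _))
  egf≈ (suc n) = sym (+-identityˡ _)

  egf-tailPower : ∀ k m → (egf ⊛ tailPower k) m ≈ Z 0 * tailPower k m + fromℕ (suc k) * tailPower (suc k) m
  egf-tailPower k m = begin
    (egf ⊛ tailPower k) m
      ≈⟨ ⊛-cong egf≈ (λ _ → refl) m ⟩
    ((λ n → monomial (Z 0) 0 n + tail n) ⊛ tailPower k) m
      ≈⟨ ⊛-distribʳ (tailPower k) _ _ m ⟩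
    (monomial (Z 0) 0 ⊛ tailPower k) m + (tail ⊛ tailPower k) m
      ≈⟨ +-cong (monomial-⊛ (Z 0) 0 _ m) (sym (dividedPower-step invS inverseS tail k m)) ⟩
    Z 0 * tailPower k m + (Poly.fromℕ seriesRing (suc k) ⊛ tailPower (suc k)) m
      ≈⟨ +-congˡ (trans (⊛-cong (fromℕ-series (suc k)) (λ _ → refl) m) (monomial-⊛ _ 0 _ m)) ⟩
    Z 0 * tailPower k m + fromℕ (suc k) * tailPower (suc k) m ∎

  -- Each term passes a carry to the next index, where `coeff-suc` recombines it into the series for
  -- r + 1; only the carry out of the last term is left over.
  egf-partialSum : ∀ r N m → (egf ⊛ partialSum r N) m ≈ partialSum (ℤ.suc r) N m + carry r N * tailPower N m
  egf-partialSum r zero    m = trans (⊛-comm egf _ m) (trans (⊛-zeroˡ egf m)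
    (sym (trans (+-congˡ (zeroˡ _)) (+-identityˡ _))))
  egf-partialSum r (suc N) m = begin
    (egf ⊛ partialSum r (suc N)) m
      ≈⟨ trans (⊛-cong (λ _ → refl) (λ i → sumL-∷ʳ _ N) m) (⊛-comm egf _ m) ⟩
    ((λ i → partialSum r N i + coeff r N * tailPower N i) ⊛ egf) m
      ≈⟨ ⊛-distribʳ egf _ _ m ⟩
    (partialSum r N ⊛ egf) m + ((λ i → coeff r N * tailPower N i) ⊛ egf) m
      ≈⟨ +-cong (⊛-comm _ egf m) (trans (⊛-scaleˡ _ _ egf m) (*-congˡ (⊛-comm _ egf m))) ⟩
    (egf ⊛ partialSum r N) m + coeff r N * (egf ⊛ tailPower N) m
      ≈⟨ +-cong (egf-partialSum r N m) (*-congˡ (egf-tailPower N m)) ⟩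
    (partialSum (ℤ.suc r) N m + carry r N * tailPower N m)
      + coeff r N * (Z 0 * tailPower N m + fromℕ (suc N) * tailPower (suc N) m)
      ≈⟨ solve 7 (λ p k t c z s u → (p :+ k :* t) :+ c :* (z :* t :+ s :* u)
                                 := (p :+ (z :* c :+ k) :* t) :+ s :* c :* u) refl _ _ _ _ _ _ _ ⟩
    (partialSum (ℤ.suc r) N m + (Z 0 * coeff r N + carry r N) * tailPower N m)
      + fromℕ (suc N) * coeff r N * tailPower (suc N) m
      ≈⟨ +-congʳ (trans (+-congˡ (*-congʳ (sym (coeff-suc r N)))) (sym (sumL-∷ʳ _ N))) ⟩
    partialSum (ℤ.suc r) (suc N) m + carry r (suc N) * tailPower (suc N) m ∎

  -- Z(t)·Z(t)ʳ = Z(t)ʳ⁺¹: with m + 1 terms, the leftover carry multiplies a series of order above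
  -- m.
  egf-potential : ∀ r m → (egf ⊛ potential r) m ≈ potential (ℤ.suc r) m
  egf-potential r m = begin
    (egf ⊛ potential r) m
      ≈⟨ ⊛-cong-≤ m (λ _ _ → refl) (λ i i≤m → potential≈partialSum r i (suc m) (s≤s i≤m)) ⟩
    (egf ⊛ partialSum r (suc m)) m
      ≈⟨ egf-partialSum r (suc m) m ⟩
    partialSum (ℤ.suc r) (suc m) m + carry r (suc m) * tailPower (suc m) m
      ≈⟨ +-cong (sym (potential≈partialSum (ℤ.suc r) m (suc m) ℕₚ.≤-refl))
                (trans (*-congˡ (dividedPower-order (suc m) m ℕₚ.≤-refl)) (zeroʳ _)) ⟩
    potential (ℤ.suc r) m + 0#
      ≈⟨ +-identityʳ _ ⟩
    potential (ℤ.suc r) m ∎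

  potential-0 : ∀ m → potential (+ 0) m ≈ monomial 1# 0 m
  potential-0 m = begin
    potential (+ 0) m
      ≈⟨ potential≈partialSum (+ 0) m (suc m) ℕₚ.≤-refl ⟩
    fromℕ 1 * 1# * monomial 1# 0 m + sumL (applyUpTo (λ j → coeff (+ 0) (suc j) * tailPower (suc j) m) m)
      ≈⟨ +-cong (trans (*-congʳ (trans (*-identityʳ _) (+-identityʳ _))) (*-identityˡ _))
                (sumL-applyUpTo-0 m (λ j → trans (*-congʳ (coeff-0 j)) (zeroˡ _))) ⟩
    monomial 1# 0 m + 0#
      ≈⟨ +-identityʳ _ ⟩
    monomial 1# 0 m ∎
    where
    coeff-0 : ∀ j → coeff (+ 0) (suc j) ≈ 0#
    coeff-0 j = trans (*-congʳ (reflexive (≡.cong fromℤ (fall-0 j)))) (zeroˡ _)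

-- Geometric sequences indexed by the integers, and the reciprocal series.

module Geometric {c ℓ} (R : CommutativeRing c ℓ) where
  open CommutativeRing R hiding (zero)
  open import Relation.Binary.Reasoning.Setoid setoid

  cancel-unit : ∀ {z w} → z * w ≈ 1# → ∀ x → z * (w * x) ≈ x
  cancel-unit zw≈1 x = trans (sym (*-assoc _ _ _)) (trans (*-congʳ zw≈1) (*-identityˡ _))

  -- The common ratio `w` is a unit, so the recurrence also runs backwards and the value at 0
  -- determines everything.
  geometric-unique : ∀ {z w} (u v : ℤ → Carrier) → z * w ≈ 1# →
    (∀ r → w * u r ≈ u (ℤ.suc r)) → (∀ r → w * v r ≈ v (ℤ.suc r)) → u (+ 0) ≈ v (+ 0) → ∀ r → u r ≈ v r
  geometric-unique {z} {w} u v zw≈1 us vs u≈v = go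
    where
    back : ∀ r → u (ℤ.suc r) ≈ v (ℤ.suc r) → u r ≈ v r
    back r e = begin
      u r             ≈⟨ sym (cancel-unit zw≈1 (u r)) ⟩
      z * (w * u r)   ≈⟨ *-congˡ (trans (us r) (trans e (sym (vs r)))) ⟩
      z * (w * v r)   ≈⟨ cancel-unit zw≈1 (v r) ⟩
      v r             ∎

    go : ∀ r → u r ≈ v r
    go (+ zero)      = u≈v
    go (+ suc n)     = trans (sym (us (+ n))) (trans (*-congˡ (go (+ n))) (vs (+ n)))
    go -[1+ zero ]   = back -[1+ 0 ] u≈v
    go -[1+ suc n ]  = back -[1+ suc n ] (go -[1+ n ])

module Reciprocal {c ℓ} (R : CommutativeRing c ℓ) (inv : ℕ → CommutativeRing.Carrier R)
  (inverse : ∀ n → MutuallyInverse R (Poly.fromℕ R (suc n)) (inv n))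
  (Z : ℕ → CommutativeRing.Carrier R) (z0inv : CommutativeRing.Carrier R)
  (unit : MutuallyInverse R (Z 0) z0inv) where
  open CommutativeRing R hiding (zero)
  open Poly R
  open WithInverses inv
  open Series R
  open Factorials R inv inverse
  private
    module S = CommutativeRing seriesRing
    module P = Potential R inv inverse Z z0inv unit

  -- Agrees by computation with the arguments inside `Aext`. Likewise its generating series `Q.egf`
  -- computes to `P.potential -[1+ 0 ]`, so it is 1/Z(t) from the outset.
  W : ℕ → Carrier
  W i = Rhat (+ i) Z z0inv

  egf-reciprocal : P.egf S.* P.potential -[1+ 0 ] S.≈ S.1#
  egf-reciprocal = S.trans (P.egf-potential -[1+ 0 ]) P.potential-0

  W-unit : W 0 * Z 0 ≈ 1#
  W-unit = trans (*-comm _ _) (trans (*-cong (sym (*-identityʳ _)) (sym (*-identityʳ _))) (egf-reciprocal 0))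

  private
    module Q = Potential R inv inverse W (Z 0) W-unit

  -- A factor Z(t) split off from Z(t)⁻ʳ cancels against 1/Z(t), so r ↦ Z(t)⁻ʳ is geometric with
  -- ratio 1/Z(t).
  reciprocal-step : ∀ r → P.potential -[1+ 0 ] S.* P.potential (ℤ.- r) S.≈ P.potential (ℤ.- ℤ.suc r)
  reciprocal-step r = S.trans
    (S.*-congˡ {x = P.potential -[1+ 0 ]} (S.trans
      (λ m → reflexive (≡.cong (λ s → P.potential s m) -r≡1-[1+r]))
      (S.sym (P.egf-potential (ℤ.- ℤ.suc r)))))
    (Geometric.cancel-unit seriesRing
      (S.trans (S.*-comm (P.potential -[1+ 0 ]) P.egf) egf-reciprocal) (P.potential (ℤ.- ℤ.suc r)))
    where
    open ℤ-Solver
    -r≡1-[1+r] : ℤ.- r ≡ ℤ.suc (ℤ.- ℤ.suc r)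
    -r≡1-[1+r] = solve 1 (λ r → :- r := con (+ 1) :+ (:- (con (+ 1) :+ r))) ≡.refl r

  -- As sequences of series in r, both sides (divided by m!) have ratio 1/Z(t) and start from 1 at r
  -- = 0.
  Phat-reciprocal : ∀ m r → Phat (+ m) r W (Z 0) ≈ Phat (+ m) (ℤ.- r) Z z0inv
  Phat-reciprocal m r = invFact-cancel m
    (Geometric.geometric-unique seriesRing {P.egf} {Q.egf} Q.potential (λ s → P.potential (ℤ.- s))
      egf-reciprocal Q.egf-potential reciprocal-step
      (S.trans Q.potential-0 (S.sym P.potential-0)) r m)

-- Binomial coefficients with integer arguments and their reflection.

-a-1≡-[1+a] : ∀ a → (ℤ.- + a) ℤ.- + 1 ≡ -[1+ a ]
-a-1≡-[1+a] zero    = ≡.refl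
-a-1≡-[1+a] (suc a) = ≡.cong (λ k → -[1+ suc k ]) (ℕₚ.+-identityʳ a)

-[1+a]-d≡-[1+a+d] : ∀ a d → -[1+ a ] ℤ.- + d ≡ -[1+ a ℕ.+ d ]
-[1+a]-d≡-[1+a+d] a zero    = ≡.cong -[1+_] (≡.sym (ℕₚ.+-identityʳ a))
-[1+a]-d≡-[1+a+d] a (suc d) = ≡.cong -[1+_] (≡.sym (ℕₚ.+-suc a d))

b≡a+d : ∀ a b d → ℤ.- + a ≡ (ℤ.- + b) ℤ.+ + d → b ≡ a ℕ.+ d
b≡a+d a b d e = ℤₚ.+-injective (≡.trans
  (solve 2 (λ b d → b := (:- ((:- b) :+ d)) :+ d) ≡.refl (+ b) (+ d))
  (≡.cong (ℤ._+ + d) (≡.trans (≡.cong ℤ.-_ (≡.sym e)) (ℤₚ.neg-involutive (+ a)))))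
  where open ℤ-Solver

m+n≮ᵇm : ∀ m n → (m ℕ.+ n ℕ.<ᵇ m) ≡ false
m+n≮ᵇm zero    n = ≡.refl
m+n≮ᵇm (suc m) n = m+n≮ᵇm m n

module Binomials {c ℓ} (R : CommutativeRing c ℓ) (inv : ℕ → CommutativeRing.Carrier R)
  (inverse : ∀ n → MutuallyInverse R (Poly.fromℕ R (suc n)) (inv n)) where
  open CommutativeRing R hiding (zero)
  open Poly R
  open WithInverses inv
  open RingHom R
  open Falling R
  open Factorials R inv inverse
  open import Algebra.Properties.Ring ring using (-‿involutive; -1*x≈-x)
  open import Algebra.Solver.Ring.NaturalCoefficients.Default commutativeSemiring
    using (solve; _:=_; _:*_)
  open import Relation.Binary.Reasoning.Setoid setoid

  -- Each factor -(a+1)-i gives up one sign, which leaves (a+1)(a+2)⋯(a+d).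
  sgn-fall-! : ∀ a d → (- 1#) ^ d * fromℤ (fall -[1+ a ] d) * fromℕ (a !) ≈ fromℕ ((a ℕ.+ d) !)
  sgn-fall-! a zero    = begin
    1# * fromℕ 1 * fromℕ (a !)   ≈⟨ *-congʳ (trans (*-identityˡ _) (+-identityʳ _)) ⟩
    1# * fromℕ (a !)             ≈⟨ *-identityˡ _ ⟩
    fromℕ (a !)                  ≡⟨ ≡.cong (λ k → fromℕ (k !)) (≡.sym (ℕₚ.+-identityʳ a)) ⟩
    fromℕ ((a ℕ.+ 0) !)          ∎
  sgn-fall-! a (suc d) = begin
    - 1# * (- 1#) ^ d * fromℤ (fall -[1+ a ] d ℤ.* (-[1+ a ] ℤ.- + d)) * fromℕ (a !)
      ≈⟨ *-congʳ (*-congˡ (fromℤ-* (fall -[1+ a ] d) (-[1+ a ] ℤ.- + d))) ⟩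
    - 1# * (- 1#) ^ d * (fromℤ (fall -[1+ a ] d) * fromℤ (-[1+ a ] ℤ.- + d)) * fromℕ (a !)
      ≡⟨ ≡.cong (λ k → - 1# * (- 1#) ^ d * (fromℤ (fall -[1+ a ] d) * fromℤ k) * fromℕ (a !))
           (-[1+a]-d≡-[1+a+d] a d) ⟩
    - 1# * (- 1#) ^ d * (fromℤ (fall -[1+ a ] d) * - fromℕ (suc (a ℕ.+ d))) * fromℕ (a !)
      ≈⟨ solve 5 (λ m s f x y → m :* s :* (f :* x) :* y := m :* x :* (s :* f :* y)) refl _ _ _ _ _ ⟩
    - 1# * - fromℕ (suc (a ℕ.+ d)) * ((- 1#) ^ d * fromℤ (fall -[1+ a ] d) * fromℕ (a !))
      ≈⟨ *-cong (trans (-1*x≈-x _) (-‿involutive _)) (sgn-fall-! a d) ⟩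
    fromℕ (suc (a ℕ.+ d)) * fromℕ ((a ℕ.+ d) !)
      ≈⟨ sym (fromℕ-* (suc (a ℕ.+ d)) ((a ℕ.+ d) !)) ⟩
    fromℕ (suc (a ℕ.+ d) !)
      ≡⟨ ≡.cong (λ k → fromℕ (k !)) (≡.sym (ℕₚ.+-suc a d)) ⟩
    fromℕ ((a ℕ.+ suc d) !) ∎

  !-cancel : ∀ n {x y} → x * fromℕ (n !) ≈ y → x ≈ y * invFact n
  !-cancel n e = trans (sym (trans (*-assoc _ _ _) (trans (*-congˡ (!-invFact n)) (*-identityʳ _)))) (*-congʳ e)

  -- The common value is (a+d)!/(a! d!).
  binomNN-reflect : ∀ a d → binomNN (+ (a ℕ.+ d)) a ≈ (- 1#) ^ d * binomNN -[1+ a ] d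
  binomNN-reflect a d = begin
    fromℤ (fall (+ (a ℕ.+ d)) a) * invFact a
      ≈⟨ *-congʳ (!-cancel d (trans (sym (fromℤ-* (fall (+ (a ℕ.+ d)) a) (+ (d !))))
                                   (reflexive (≡.cong fromℤ (fall-! a d))))) ⟩
    fromℕ ((a ℕ.+ d) !) * invFact d * invFact a
      ≈⟨ solve 3 (λ x y z → x :* y :* z := x :* z :* y) refl _ _ _ ⟩
    fromℕ ((a ℕ.+ d) !) * invFact a * invFact d
      ≈⟨ *-congʳ (sym (!-cancel a (sgn-fall-! a d))) ⟩
    (- 1#) ^ d * fromℤ (fall -[1+ a ] d) * invFact d
      ≈⟨ *-assoc _ _ _ ⟩
    (- 1#) ^ d * binomNN -[1+ a ] d ∎

  sgn²≈1 : ∀ d → (- 1#) ^ d * (- 1#) ^ d ≈ 1#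
  sgn²≈1 zero    = *-identityˡ _
  sgn²≈1 (suc d) = trans (solve 2 (λ m s → m :* s :* (m :* s) := m :* m :* (s :* s)) refl _ _)
    (trans (*-cong (trans (-1*x≈-x _) (-‿involutive _)) (sgn²≈1 d)) (*-identityˡ _))

  binomZ-neg : ∀ a d → binomZ -[1+ a ] -[1+ a ℕ.+ d ] ≈ binomNN -[1+ a ] d
  binomZ-neg a d rewrite m+n≮ᵇm a d | ℕₚ.m+n∸m≡n a d = refl

  -- `d` stands for n - k but is a separate argument, so that each sign case can choose its own
  -- parametrisation of n and k.
  Reflects : ℤ → ℤ → ℕ → Set ℓ
  Reflects n k d = binomZ (n ℤ.- + 1) (k ℤ.- + 1) ≈ (- 1#) ^ d * binomZ (ℤ.- k) (ℤ.- n)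

  reflects-positive : ∀ K d → Reflects (+ suc (K ℕ.+ d)) (+ suc K) d
  reflects-positive K d = trans (binomNN-reflect K d) (*-congˡ (sym (binomZ-neg K d)))

  -- Both coefficients vanish, having a nonnegative upper and a negative lower argument: N over
  -- -b-1, and b over -N-1.
  reflects-mixed : ∀ N b d → Reflects (+ suc N) (ℤ.- + b) d
  reflects-mixed N b d rewrite -a-1≡-[1+a] b | ℤₚ.neg-involutive (+ b) = sym (zeroʳ _)

  -- The positive case with its sides exchanged; the sign crosses over because its square is 1.
  reflects-nonpositive : ∀ a d → Reflects (ℤ.- + a) (ℤ.- + (a ℕ.+ d)) d
  reflects-nonpositive a d rewrite -a-1≡-[1+a] a | -a-1≡-[1+a] (a ℕ.+ d)
    | ℤₚ.neg-involutive (+ a) | ℤₚ.neg-involutive (+ (a ℕ.+ d)) = begin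
    binomZ -[1+ a ] -[1+ a ℕ.+ d ]                         ≈⟨ binomZ-neg a d ⟩
    binomNN -[1+ a ] d                                     ≈⟨ sym (*-identityˡ _) ⟩
    1# * binomNN -[1+ a ] d                                ≈⟨ *-congʳ (sym (sgn²≈1 d)) ⟩
    (- 1#) ^ d * (- 1#) ^ d * binomNN -[1+ a ] d           ≈⟨ *-assoc _ _ _ ⟩
    (- 1#) ^ d * ((- 1#) ^ d * binomNN -[1+ a ] d)         ≈⟨ *-congˡ (sym (binomNN-reflect a d)) ⟩
    (- 1#) ^ d * binomNN (+ (a ℕ.+ d)) a                   ∎

  -- Writing nonpositive integers as `ℤ.- + b` lets zero share the treatment of negative numbers.
  -- For n = -a the hypothesis forces b = a + d.
  reflects-k≤0 : ∀ n b d → n ≡ (ℤ.- + b) ℤ.+ + d → Reflects n (ℤ.- + b) d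
  reflects-k≤0 (+ suc N) b d e = reflects-mixed N b d
  reflects-k≤0 (+ zero)  b d e = ≡.subst (λ x → Reflects (+ 0) (ℤ.- + x) d)
    (≡.sym (b≡a+d 0 b d e)) (reflects-nonpositive 0 d)
  reflects-k≤0 -[1+ a ]  b d e = ≡.subst (λ x → Reflects -[1+ a ] (ℤ.- + x) d)
    (≡.sym (b≡a+d (suc a) b d e)) (reflects-nonpositive (suc a) d)

  binomZ-reflect : ∀ n k d → n ≡ k ℤ.+ + d → Reflects n k d
  binomZ-reflect n (+ suc K) d ≡.refl = reflects-positive K d
  binomZ-reflect n (+ zero)  d e      = reflects-k≤0 n 0 d e
  binomZ-reflect n -[1+ b ]  d e      = reflects-k≤0 n (suc b) d e

-- Assembly of the reciprocal-series identity and the binomial reflection.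

theorem8p3 : ∀ {c ℓ} (R : CommutativeRing c ℓ) →
    let open CommutativeRing R in
    (inv : ℕ → Carrier) → (∀ n → Poly.fromℕ R (suc n) * inv n ≈ 1#) →
    (Q : ℕ → ℕ → Carrier) →
    (H : ℕ → Carrier) → (∀ n k → 1 ≤ k → k ≤ n → Q n k ≈ Poly.Bell R n k H) →
    (q11inv : Carrier) → Q 1 1 * q11inv ≈ 1# →
    ∀ (n k : ℤ) →
    Poly.WithInverses.Aext R inv n k (λ j → Q j 1) q11inv
    ≈ Poly.sgn R (n ℤ.- k)
    * Poly.WithInverses.Bext R inv (ℤ.- k) (ℤ.- n) (λ j → Q j 1) q11inv
theorem8p3 R inv inverse Q H _ q11inv q11-unit n k = go (n ℤ.- k) ≡.refl
  where
  open CommutativeRing R hiding (zero)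
  open Poly R
  open WithInverses inv
  open import Relation.Binary.Reasoning.Setoid setoid
  open import Algebra.Properties.CommutativeSemigroup *-commutativeSemigroup using (interchange)

  Z : ℕ → Carrier
  Z = Yshift (λ j → Q j 1)

  unit : Z 0 * (q11inv * fromℕ 1) ≈ 1#
  unit = begin
    Q 1 1 * inv 0 * (q11inv * fromℕ 1)     ≈⟨ interchange _ _ _ _ ⟩
    Q 1 1 * q11inv * (inv 0 * fromℕ 1)     ≈⟨ *-cong q11-unit (trans (*-comm _ _) (inverse 0)) ⟩
    1# * 1#                                ≈⟨ *-identityˡ _ ⟩
    1#                                     ∎

  open Reciprocal R inv inverse Z (q11inv * fromℕ 1) unit
  open Binomials R inv inverse

  -k+n≡n-k : (ℤ.- k) ℤ.- (ℤ.- n) ≡ n ℤ.- k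
  -k+n≡n-k = solve 2 (λ n k → (:- k) :- (:- n) := n :- k) ≡.refl n k
    where open ℤ-Solver

  n≡k+[n-k] : n ≡ k ℤ.+ (n ℤ.- k)
  n≡k+[n-k] = solve 2 (λ n k → n := k :+ (n :- k)) ≡.refl n k
    where open ℤ-Solver

  go : ∀ x → n ℤ.- k ≡ x → Aext n k (λ j → Q j 1) q11inv
         ≈ sgn (n ℤ.- k) * Bext (ℤ.- k) (ℤ.- n) (λ j → Q j 1) q11inv
  -- n - k is the degree of both potential polynomials, so for n < k both vanish.
  go -[1+ d ] e rewrite -k+n≡n-k | e = trans (zeroʳ _) (sym (trans (*-congˡ (zeroʳ _)) (zeroʳ _)))
  go (+ d)    e rewrite -k+n≡n-k | e = begin
    binomZ (n ℤ.- + 1) (k ℤ.- + 1) * Phat (+ d) n W (Z 0)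
      ≈⟨ *-cong (binomZ-reflect n k d (≡.trans n≡k+[n-k] (≡.cong (λ x → k ℤ.+ x) e))) (Phat-reciprocal d n) ⟩
    (- 1#) ^ d * binomZ (ℤ.- k) (ℤ.- n) * Phat (+ d) (ℤ.- n) Z (q11inv * fromℕ 1)
      ≈⟨ *-assoc _ _ _ ⟩
    (- 1#) ^ d * (binomZ (ℤ.- k) (ℤ.- n) * Phat (+ d) (ℤ.- n) Z (q11inv * fromℕ 1)) ∎
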